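{- Let $(G_n)_{n\ge 0}$ be the sequence of graphs defined in the context, let $T_n(x,y)=T(G_n;x,y)$ be the Tutte polynomial of $G_n$, and let $\tau(G_n)$ be the number of spanning trees of $G_n$. The number of spanning trees of $G_n$ is given by $$\tau(G_n)=T_n(1,1)=8^{\frac{4^n-1}{3}}=2^{4^n-1},$$ and the asymptotic growth constant is $$\lim_{n\to\infty}\frac{\ln\tau(G_n)}{|V(G_n)|}=\frac{3}{2}\ln 2\;(\approx 1.0397).$$
   Context: Tutte polynomial: for a graph $G$ with vertex set $V(G)$, edge set $E(G)$ and $k(G)$ connected components, put $r(G)=|V(G)|-k(G)$ and $n(G)=|E(G)|-|V(G)|+k(G)$. Then $T(G;x,y)=\sum_{H\subseteq G}(x-1)^{r(G)-r(H)}(y-1)^{n(H)}$, where the sum runs over all spanning subgraphs $H$ of $G$ (subgraphs with $V(H)=V(G)$ and arbitrary $E(H)\subseteq E(G)$). For a connected graph $G$, $T(G;1,1)=\tau(G)$ is the number of spanning trees of $G$. The graphs $G_n$: $G_0$ is the complete graph $K_2$ with its two vertices denoted $X_0,Y_0$. For $n\ge 0$, given $G_n$ with two special vertices $X_n,Y_n$, take four disjoint copies $G_n^1,G_n^2,G_n^3,G_n^4$ of $G_n$, with special vertices $X_n^i,Y_n^i$. Identify $X_n^1$ with $X_n^2$ to form the special vertex $X_{n+1}$ of $G_{n+1}$; identify $Y_n^3$ with $Y_n^4$ to form the special vertex $Y_{n+1}$ of $G_{n+1}$; identify $Y_n^1$ with $X_n^3$ to form a vertex $a$, and $Y_n^2$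 with $X_n^4$ to form a vertex $b$; finally add a new edge $e_n$ joining $a$ and $b$. The result is $G_{n+1}$. -}

module Defs where

open import Data.Fin.Base as Fin using (Fin; zero; suc; combine; fromℕ<)
open import Data.Fin.Patterns using (0F; 1F; 2F; 3F)
import Data.Fin.Properties as Fin
open import Data.Integer.Base as ℤ using (ℤ; +_; 0ℤ; 1ℤ)
import Data.Integer.Properties as ℤ
import Data.Integer.Tactic.RingSolver as ℤ
open import Data.List.Base as List
  using (List; []; _∷_; _++_; map; concatMap; filter; foldr; length; allFin; deduplicate)
open import Data.List.Membership.Propositional using (_∈_)
open import Data.List.Relation.Unary.Any using (here; there)
open import Data.Nat.Base as ℕ using (ℕ; zero; suc; z≤n; s≤s; s≤s⁻¹; _∸_)
import Data.Nat.Properties as ℕ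
open import Data.Nat.Tactic.RingSolver using (solve-∀)
open import Data.Product.Base using (_×_; _,_; ∃; ∃-syntax; proj₁; proj₂)
import Data.Product.Properties as Product
open import Data.Rational.Base as ℚ using (ℚ; 0ℚ; 1ℚ; mkℚ; _/_; ∣_∣; *≤*; *<*)
import Data.Rational.Properties as ℚ
import Data.Rational.Solver as ℚ
import Data.Rational.Unnormalised.Base as ℚᵘ
import Data.Rational.Unnormalised.Properties as ℚᵘ
open import Data.Sum.Base using (_⊎_; inj₁; inj₂)
open import Data.Vec.Base as Vec using (Vec; []; _∷_; _∷ʳ_)
open import Data.Vec.Relation.Unary.AllPairs using (allPairs?)
open import Data.Vec.Relation.Unary.Unique.Propositional using (Unique)
import Data.Vec.Relation.Unary.Unique.Propositional.Properties as Unique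
open import Function.Base using (_∘_)
open import Relation.Binary.Construct.Closure.Equivalence as Eq using (EqClosure)
open import Relation.Binary.Construct.Closure.ReflexiveTransitive
  using (ε; _◅_; _◅◅_)
open import Relation.Binary.Construct.Closure.Symmetric using (fwd; bwd)
open import Relation.Binary.Definitions using (Decidable)
open import Relation.Binary.PropositionalEquality
  using (_≡_; refl; sym; trans; cong; cong₂; subst)
open import Relation.Nullary.Decidable using (Dec; yes; no; map′; _×-dec_; _⊎-dec_; ¬?)
open import Relation.Nullary.Negation using (¬_)
import Relation.Unary as U

------------------------------------------------------------------------
-- Graphs

-- Finite undirected multigraphs: the orientation of the pair that stores
-- an edge is irrelevant, and equal pairs at different positions of the
-- list are different (parallel) edges.

record Graph : Set where
  constructor graph
  field
    ∣V∣   : ℕ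
    edges : List (Fin ∣V∣ × Fin ∣V∣)

  ∣E∣ : ℕ
  ∣E∣ = length edges

open Graph public

EdgesConnect : ∀ {n} → List (Fin n × Fin n) → Fin n → Fin n → Set
EdgesConnect es = EqClosure (λ u v → (u , v) ∈ es)

Connects : (G : Graph) → Fin (∣V∣ G) → Fin (∣V∣ G) → Set
Connects G = EdgesConnect (edges G)

module _ {n : ℕ} (a b : Fin n) (es : List (Fin n × Fin n)) where

  private
    _~_ _~′_ : Fin n → Fin n → Set
    _~_  = EdgesConnect es
    _~′_ = EdgesConnect ((a , b) ∷ es)

    Cases : Fin n → Fin n → Set
    Cases u v = u ~ v ⊎ (u ~ a × b ~ v) ⊎ (u ~ b × a ~ v)

    weaken : ∀ {u v} → u ~ v → u ~′ v
    weaken = Eq.map there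

    fromCases : ∀ {u v} → Cases u v → u ~′ v
    fromCases (inj₁ p)              = weaken p
    fromCases (inj₂ (inj₁ (p , q))) = weaken p ◅◅ fwd (here refl) ◅ weaken q
    fromCases (inj₂ (inj₂ (p , q))) = weaken p ◅◅ bwd (here refl) ◅ weaken q

    prepend : ∀ {u w v} → u ~ w → Cases w v → Cases u v
    prepend r (inj₁ p)              = inj₁ (r ◅◅ p)
    prepend r (inj₂ (inj₁ (p , q))) = inj₂ (inj₁ (r ◅◅ p , q))
    prepend r (inj₂ (inj₂ (p , q))) = inj₂ (inj₂ (r ◅◅ p , q))

    viaAB : ∀ {v} → Cases b v → Cases a v
    viaAB (inj₁ p)              = inj₂ (inj₁ (ε , p))
    viaAB (inj₂ (inj₁ (_ , q))) = inj₂ (inj₁ (ε , q))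
    viaAB (inj₂ (inj₂ (_ , q))) = inj₁ q

    viaBA : ∀ {v} → Cases a v → Cases b v
    viaBA (inj₁ p)              = inj₂ (inj₂ (ε , p))
    viaBA (inj₂ (inj₁ (_ , q))) = inj₁ q
    viaBA (inj₂ (inj₂ (_ , q))) = inj₂ (inj₂ (ε , q))

    toCases : ∀ {u v} → u ~′ v → Cases u v
    toCases ε                         = inj₁ ε
    toCases (fwd (here refl)  ◅ rest) = viaAB (toCases rest)
    toCases (bwd (here refl)  ◅ rest) = viaBA (toCases rest)
    toCases (fwd (there e∈es) ◅ rest) = prepend (fwd e∈es ◅ ε) (toCases rest)
    toCases (bwd (there e∈es) ◅ rest) = prepend (bwd e∈es ◅ ε) (toCases rest)

  edgesConnect-∷? : Decidable _~_ → Decidable _~′_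
  edgesConnect-∷? _~?_ u v = map′ fromCases toCases
    ((u ~? v) ⊎-dec ((u ~? a) ×-dec (b ~? v)) ⊎-dec ((u ~? b) ×-dec (a ~? v)))

edgesConnect? : ∀ {n} (es : List (Fin n × Fin n)) → Decidable (EdgesConnect es)
edgesConnect? [] u v = map′ (λ { refl → ε }) (λ { ε → refl ; (fwd () ◅ _) ; (bwd () ◅ _) })
                            (u Fin.≟ v)
edgesConnect? ((a , b) ∷ es) = edgesConnect-∷? a b es (edgesConnect? es)

connects? : ∀ G → Decidable (Connects G)
connects? G = edgesConnect? (edges G)

-- Deduplicating the vertices up to connectedness leaves one vertex per
-- connected component.

components : Graph → ℕ
components G = length (deduplicate (connects? G) (allFin (∣V∣ G)))

------------------------------------------------------------------------
-- The Tutte polynomial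

sublists : ∀ {A : Set} → List A → List (List A)
sublists []       = [] ∷ []
sublists (x ∷ xs) = map (x ∷_) (sublists xs) ++ sublists xs

spanningSubgraphs : Graph → List Graph
spanningSubgraphs G = map (graph (∣V∣ G)) (sublists (edges G))

-- The truncated subtractions in rank, nullity and the exponent in tutte
-- never truncate: k(G) ≤ |V(G)| ≤ |E(G)| + k(G), and k(G) ≤ k(H) for a
-- spanning subgraph H of G.

rank : Graph → ℕ
rank G = ∣V∣ G ∸ components G

nullity : Graph → ℕ
nullity G = (∣E∣ G ℕ.+ components G) ∸ ∣V∣ G

tutte : Graph → ℤ → ℤ → ℤ
tutte G x y = foldr ℤ._+_ 0ℤ (map term (spanningSubgraphs G))
  where
  term : Graph → ℤ
  term H = (x ℤ.- 1ℤ) ℤ.^ (rank G ∸ rank H) ℤ.* (y ℤ.- 1ℤ) ℤ.^ nullity H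

------------------------------------------------------------------------
-- Spanning trees

Connected : Graph → Set
Connected G = ∀ u v → Connects G u v

Joins : (G : Graph) → Fin (∣E∣ G) → Fin (∣V∣ G) → Fin (∣V∣ G) → Set
Joins G e u v = List.lookup (edges G) e ≡ (u , v) ⊎ List.lookup (edges G) e ≡ (v , u)

rotate : ∀ {A : Set} {n} → Vec A (suc n) → Vec A (suc n)
rotate (x ∷ xs) = xs ∷ʳ x

-- Distinct vertices v₀, …, vₗ and distinct edges e₀, …, eₗ, where eᵢ joins
-- vᵢ to vᵢ₊₁ and eₗ joins vₗ to v₀. Loops and pairs of parallel edges are
-- cycles.

IsCycle : (G : Graph) → ∀ {l} → Vec (Fin (∣V∣ G)) (suc l) → Vec (Fin (∣E∣ G)) (suc l) → Set
IsCycle G vs es = Unique vs × Unique es ×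
  (∀ i → Joins G (Vec.lookup es i) (Vec.lookup vs i) (Vec.lookup (rotate vs) i))

HasCycle : Graph → Set
HasCycle G = ∃[ l ] ∃[ vs ] ∃[ es ] IsCycle G {l} vs es

IsTree : Graph → Set
IsTree G = Connected G × ¬ HasCycle G

anyVec? : ∀ {m} k {P : Vec (Fin m) k → Set} → U.Decidable P → Dec (∃ P)
anyVec? zero    P? = map′ ([] ,_) (λ { ([] , p) → p }) (P? [])
anyVec? (suc k) P? = map′ (λ { (x , xs , p) → x ∷ xs , p }) (λ { (x ∷ xs , p) → x , xs , p })
                          (Fin.any? λ x → anyVec? k (P? ∘ (x ∷_)))

isCycle? : ∀ G {l} vs es → Dec (IsCycle G {l} vs es)
isCycle? G vs es =
  unique? vs ×-dec unique? es ×-dec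
  Fin.all? (λ i → (_ ≟ₑ _) ⊎-dec (_ ≟ₑ _))
  where
  _≟ₑ_ = Product.≡-dec (Fin._≟_ {∣V∣ G}) (Fin._≟_ {∣V∣ G})

  unique? : ∀ {n k} (xs : Vec (Fin n) k) → Dec (Unique xs)
  unique? = allPairs? (λ x y → ¬? (x Fin.≟ y))

hasCycle? : U.Decidable HasCycle
hasCycle? G = map′ from to
  (Fin.any? λ (l : Fin (∣V∣ G)) → anyVec? _ λ vs → anyVec? _ λ es → isCycle? G vs es)
  where
  CycleOfLength : ℕ → Set
  CycleOfLength l = ∃[ vs ] ∃[ es ] IsCycle G {l} vs es

  from : (∃[ l ] CycleOfLength (Fin.toℕ {∣V∣ G} l)) → HasCycle G
  from (l , c) = Fin.toℕ l , c

  to : HasCycle G → ∃[ l ] CycleOfLength (Fin.toℕ {∣V∣ G} l)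
  to (l , c@(vs , _ , distinct , _)) =
    fromℕ< l<∣V∣ , subst CycleOfLength (sym (Fin.toℕ-fromℕ< l<∣V∣)) c
    where
    l<∣V∣ : l ℕ.< ∣V∣ G
    l<∣V∣ = Fin.injective⇒≤ {f = Vec.lookup vs} (Unique.lookup-injective distinct _ _)

isTree? : U.Decidable IsTree
isTree? G = Fin.all? (λ u → Fin.all? (connects? G u)) ×-dec ¬? (hasCycle? G)

τ : Graph → ℕ
τ G = length (filter isTree? (spanningSubgraphs G))

------------------------------------------------------------------------
-- The graphs Gₙ

-- A graph with two special vertices X = 0F and Y = 1F.

record Marked : Set where
  constructor marked
  field
    inner    : ℕ
    edgeList : List (Fin (2 ℕ.+ inner) × Fin (2 ℕ.+ inner))

  underlying : Graph
  underlying = graph (2 ℕ.+ inner) edgeList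

open Marked public

-- Vertices of four copies of a marked graph after the identifications:
-- X = 0F, Y = 1F, a = 2F, b = 3F, followed by the inner vertices of each
-- copy. The map `place i` sends a vertex of the copy i (copies are numbered
-- from 0) to its class; only the special vertices are identified.

place : ∀ {k} → Fin 4 → Fin (2 ℕ.+ k) → Fin (2 ℕ.+ (2 ℕ.+ 4 ℕ.* k))
place 0F 0F = 0F
place 1F 0F = 0F
place 2F 0F = 2F
place 3F 0F = 3F
place 0F 1F = 2F
place 1F 1F = 3F
place 2F 1F = 1F
place 3F 1F = 1F
place i (suc (suc v)) = suc (suc (suc (suc (combine i v))))

glue : Marked → Marked
glue (marked k es) = marked (2 ℕ.+ 4 ℕ.* k)
  ((2F , 3F) ∷ concatMap (λ i → map (λ (u , v) → place i u , place i v) es) (allFin 4))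

markedG : ℕ → Marked
markedG zero    = marked 0 ((0F , 1F) ∷ [])
markedG (suc n) = glue (markedG n)

G : ℕ → Graph
G n = underlying (markedG n)

------------------------------------------------------------------------
-- Real numbers

-- Cauchy sequences of rationals.

record ℝ : Set where
  field
    seq    : ℕ → ℚ
    cauchy : ∀ δ → 0ℚ ℚ.< δ →
             ∃[ K ] ∀ m n → K ℕ.≤ m → K ℕ.≤ n → ∣ seq m ℚ.- seq n ∣ ℚ.≤ δ

open ℝ public

-- The slack δ makes this the order of the reals represented by x and y.

∣_-_∣≤_ : ℝ → ℝ → ℚ → Set
∣ x - y ∣≤ r = ∀ δ → 0ℚ ℚ.< δ →
  ∃[ K ] ∀ k → K ℕ.≤ k → ∣ seq x k ℚ.- seq y k ∣ ℚ.≤ r ℚ.+ δ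

_⟶_ : (ℕ → ℝ) → ℝ → Set
x ⟶ y = ∀ δ → 0ℚ ℚ.< δ → ∃[ N ] ∀ n → N ℕ.≤ n → ∣ x n - y ∣≤ δ

fromℚ : ℚ → ℝ
fromℚ q .seq _ = q
fromℚ q .cauchy δ 0<δ = 0 , λ _ _ _ _ →
  ℚ.≤-trans (ℚ.≤-reflexive (cong ∣_∣ (ℚ.+-inverseʳ q))) (ℚ.<⇒≤ 0<δ)

infixr 7 _·_

_·_ : ℚ → ℝ → ℝ
(q · x) .seq n = q ℚ.* seq x n
(q · x) .cauchy δ 0<δ = proj₁ K , bound
  where
  c : ℚ
  c = 1ℚ ℚ.+ ∣ q ∣

  instance
    c-positive : ℚ.Positive c
    c-positive = ℚ.pos+nonNeg⇒pos 1ℚ ∣ q ∣ {{ℚ.∣-∣-nonNeg q}}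

    c-nonZero : ℚ.NonZero c
    c-nonZero = ℚ.pos⇒nonZero c

    c-nonNegative : ℚ.NonNegative c
    c-nonNegative = ℚ.pos⇒nonNeg c

  δ/c : ℚ
  δ/c = ℚ.1/ c ℚ.* δ

  K : ∃[ K ] ∀ m n → K ℕ.≤ m → K ℕ.≤ n → ∣ seq x m ℚ.- seq x n ∣ ℚ.≤ δ/c
  K = cauchy x δ/c (ℚ.positive⁻¹ δ/c
        {{ℚ.pos*pos⇒pos (ℚ.1/ c) {{ℚ.1/pos⇒pos c}} δ {{ℚ.positive 0<δ}}}})

  bound : ∀ m n → proj₁ K ℕ.≤ m → proj₁ K ℕ.≤ n →
          ∣ q ℚ.* seq x m ℚ.- q ℚ.* seq x n ∣ ℚ.≤ δ
  bound m n K≤m K≤n = begin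
    ∣ q ℚ.* seq x m ℚ.- q ℚ.* seq x n ∣  ≡⟨ cong ∣_∣ (factor q (seq x m) (seq x n)) ⟩
    ∣ q ℚ.* d ∣                          ≡⟨ ℚ.∣p*q∣≡∣p∣*∣q∣ q d ⟩
    ∣ q ∣ ℚ.* ∣ d ∣                      ≤⟨ ℚ.*-monoʳ-≤-nonNeg ∣ d ∣ {{ℚ.∣-∣-nonNeg d}} ∣q∣≤c ⟩
    c ℚ.* ∣ d ∣                          ≤⟨ ℚ.*-monoˡ-≤-nonNeg c (proj₂ K m n K≤m K≤n) ⟩
    c ℚ.* (ℚ.1/ c ℚ.* δ)                 ≡⟨ ℚ.*-assoc c (ℚ.1/ c) δ ⟨
    c ℚ.* ℚ.1/ c ℚ.* δ                   ≡⟨ cong (ℚ._* δ) (ℚ.*-inverseʳ c) ⟩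
    1ℚ ℚ.* δ                             ≡⟨ ℚ.*-identityˡ δ ⟩
    δ                                    ∎
    where
    open ℚ.≤-Reasoning
    open ℚ.+-*-Solver
    d : ℚ
    d = seq x m ℚ.- seq x n
    factor : ∀ q a b → q ℚ.* a ℚ.- q ℚ.* b ≡ q ℚ.* (a ℚ.- b)
    factor = solve 3 (λ q a b → q :* a :- q :* b := q :* (a :- b)) refl
    ∣q∣≤c : ∣ q ∣ ℚ.≤ c
    ∣q∣≤c = ℚ.≤-trans (ℚ.≤-reflexive (sym (ℚ.+-identityˡ ∣ q ∣)))
                      (ℚ.+-monoˡ-≤ ∣ q ∣ (ℚ.nonNegative⁻¹ 1ℚ))

_÷_ : ℝ → (n : ℕ) → .{{ℕ.NonZero n}} → ℝ
x ÷ n = (+ 1 / n) · x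

------------------------------------------------------------------------
-- The logarithm of a natural number

∑ : ℕ → (ℕ → ℚ) → ℚ
∑ zero    f = 0ℚ
∑ (suc n) f = ∑ n f ℚ.+ f n

-- With N = suc n, the right Riemann sum of ∫₁ᵐ dt/t of mesh 1/N:
-- the sum over 0 ≤ i < (m-1)N of 1/N · 1/(1 + (i+1)/N) = 1/(N + i + 1).

riemann : ℕ → ℕ → ℚ
riemann m n = ∑ ((m ∸ 1) ℕ.* suc n) (λ i → + 1 / (suc n ℕ.+ suc i))

unit : ℕ → ℚ
unit n = + 1 / suc n

unit≡mkℚ : ∀ n → unit n ≡ mkℚ (+ 1) n _
unit≡mkℚ n = ℚ.↥p/↧p≡p (mkℚ (+ 1) n (Coprime.1-coprimeTo (suc n)))
  where import Data.Nat.Coprimality as Coprime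

unit-antitone : ∀ {m n} → m ℕ.≤ n → unit n ℚ.≤ unit m
unit-antitone {m} {n} m≤n rewrite unit≡mkℚ m | unit≡mkℚ n =
  *≤* (ℤ.+≤+ (ℕ.*-monoʳ-≤ 1 (s≤s m≤n)))

unit-nonNegative : ∀ n → 0ℚ ℚ.≤ unit n
unit-nonNegative n rewrite unit≡mkℚ n = *≤* (ℤ.+≤+ z≤n)

unit-small : ∀ δ → 0ℚ ℚ.< δ → ∃[ K ] unit K ℚ.≤ δ
unit-small (mkℚ (+ zero) d _) (*<* (ℤ.+<+ ()))
unit-small (mkℚ (+ suc p) d _) _ = d , le
  where
  le : unit d ℚ.≤ mkℚ (+ suc p) d _
  le rewrite unit≡mkℚ d = *≤* (ℤ.+≤+ (ℕ.*-monoˡ-≤ (suc d) (s≤s (z≤n {p}))))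
unit-small (mkℚ ℤ.-[1+ _ ] d _) (*<* ())

∑-mono : ∀ n {f g} → (∀ i → i ℕ.< n → f i ℚ.≤ g i) → ∑ n f ℚ.≤ ∑ n g
∑-mono zero    f≤g = ℚ.≤-refl
∑-mono (suc n) f≤g =
  ℚ.+-mono-≤ (∑-mono n (λ i i<n → f≤g i (ℕ.m<n⇒m<1+n i<n))) (f≤g n ℕ.≤-refl)

∑-cong : ∀ n {f g} → (∀ i → f i ≡ g i) → ∑ n f ≡ ∑ n g
∑-cong zero    f≡g = refl
∑-cong (suc n) f≡g = cong₂ ℚ._+_ (∑-cong n f≡g) (f≡g n)

∑-+ : ∀ m n f → ∑ (m ℕ.+ n) f ≡ ∑ m f ℚ.+ ∑ n (λ j → f (m ℕ.+ j))
∑-+ m zero    f rewrite ℕ.+-identityʳ m = sym (ℚ.+-identityʳ _)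
∑-+ m (suc n) f rewrite ℕ.+-suc m n | ∑-+ m n f = ℚ.+-assoc (∑ m f) _ _

∑-* : ∀ m n f → ∑ (m ℕ.* n) f ≡ ∑ m (λ i → ∑ n (λ j → f (i ℕ.* n ℕ.+ j)))
∑-* zero    n f = refl
∑-* (suc m) n f rewrite ℕ.+-comm n (m ℕ.* n) | ∑-+ (m ℕ.* n) n f | ∑-* m n f = refl

∑-shift : ∀ n f → ∑ n f ℚ.+ f n ≡ f 0 ℚ.+ ∑ n (f ∘ suc)
∑-shift zero    f = ℚ.+-comm 0ℚ (f 0)
∑-shift (suc n) f rewrite ∑-shift n f = ℚ.+-assoc (f 0) _ _

∑-const : ∀ n p → ∑ n (λ _ → unit p) ≡ + n / suc p
∑-const zero    p = sym (ℚ.0/n≡0 (suc p))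
∑-const (suc n) p rewrite ∑-const n p = ℚ.toℚᵘ-injective (begin
  ℚ.toℚᵘ (+ n / suc p ℚ.+ unit p)             ≈⟨ ℚ.toℚᵘ-homo-+ (+ n / suc p) (unit p) ⟩
  ℚ.toℚᵘ (+ n / suc p) ℚᵘ.+ ℚ.toℚᵘ (unit p)   ≈⟨ ℚᵘ.+-cong (ℚ.toℚᵘ-fromℚᵘ (ℚᵘ.mkℚᵘ (+ n) p))
                                                          (ℚ.toℚᵘ-fromℚᵘ (ℚᵘ.mkℚᵘ (+ 1) p)) ⟩
  ℚᵘ.mkℚᵘ (+ n) p ℚᵘ.+ ℚᵘ.mkℚᵘ (+ 1) p     ≈⟨ ℚᵘ.*≡* (arith (+ n) (+ suc p)) ⟩
  ℚᵘ.mkℚᵘ (+ suc n) p                      ≈⟨ ℚ.toℚᵘ-fromℚᵘ (ℚᵘ.mkℚᵘ (+ suc n) p) ⟨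
  ℚ.toℚᵘ (+ suc n / suc p)                 ∎)
  where
  open ℚᵘ.≃-Reasoning
  arith : ∀ a d → (a ℤ.* d ℤ.+ 1ℤ ℤ.* d) ℤ.* d ≡ (1ℤ ℤ.+ a) ℤ.* (d ℤ.* d)
  arith = ℤ.solve-∀

∑-block : ∀ n k → ∑ (suc n) (λ _ → unit (n ℕ.+ k ℕ.* suc n)) ≡ unit k
∑-block n k = trans (∑-const (suc n) (n ℕ.+ k ℕ.* suc n))
  (ℚ.fromℚᵘ-cong {ℚᵘ.mkℚᵘ (+ suc n) (n ℕ.+ k ℕ.* suc n)} {ℚᵘ.mkℚᵘ (+ 1) k}
    (ℚᵘ.*≡* (cong +_ (arith (suc n) (suc k)))))
  where
  arith : ∀ a b → a ℕ.* b ≡ 1 ℕ.* (b ℕ.* a)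
  arith = solve-∀

mesh1/ : ℕ → ℕ → ℚ
mesh1/ N m = ∑ ((m ∸ 1) ℕ.* N) (λ t → unit (N ℕ.+ t))

refined : ℕ → ℕ → ℕ → ℚ
refined m p n = mesh1/ (suc p ℕ.* suc n) m

refined-comm : ∀ m p n → refined m p n ≡ refined m n p
refined-comm m p n = cong (λ N → mesh1/ N m) (ℕ.*-comm (suc p) (suc n))

blocks : ℕ → ℕ → ℕ → ℚ
blocks m p n = ∑ ((m ∸ 1) ℕ.* suc p)
                 (λ i → ∑ (suc n) (λ j → unit ((suc p ℕ.+ i) ℕ.* suc n ℕ.+ j)))

refined≡blocks : ∀ m p n → refined m p n ≡ blocks m p n
refined≡blocks m p n = trans
  (cong (λ k → ∑ k f) (sym (ℕ.*-assoc (m ∸ 1) (suc p) (suc n))))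
  (trans (∑-* ((m ∸ 1) ℕ.* suc p) (suc n) f)
    (∑-cong ((m ∸ 1) ℕ.* suc p) λ i → ∑-cong (suc n) λ j → cong unit (arith (suc p) (suc n) i j)))
  where
  f : ℕ → ℚ
  f t = unit (suc p ℕ.* suc n ℕ.+ t)
  arith : ∀ a b i j → a ℕ.* b ℕ.+ (i ℕ.* b ℕ.+ j) ≡ (a ℕ.+ i) ℕ.* b ℕ.+ j
  arith = solve-∀

riemann≤refined : ∀ m p n → riemann m p ℚ.≤ refined m p n
riemann≤refined m p n = begin
  riemann m p                                ≡⟨ ∑-cong K (λ i → cong unit (ℕ.+-suc p i)) ⟩
  ∑ K (λ i → unit (suc p ℕ.+ i))                ≤⟨ ∑-mono K (λ i _ → block i) ⟩
  blocks m p n                               ≡⟨ refined≡blocks m p n ⟨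
  refined m p n                              ∎
  where
  open ℚ.≤-Reasoning
  K : ℕ
  K = (m ∸ 1) ℕ.* suc p
  block : ∀ i → unit (suc p ℕ.+ i) ℚ.≤ ∑ (suc n) (λ j → unit ((suc p ℕ.+ i) ℕ.* suc n ℕ.+ j))
  block i = ℚ.≤-trans (ℚ.≤-reflexive (sym (∑-block n (suc p ℕ.+ i))))
    (∑-mono (suc n) λ j j<N → unit-antitone
      (ℕ.≤-trans (ℕ.+-monoʳ-≤ ((suc p ℕ.+ i) ℕ.* suc n) (s≤s⁻¹ j<N))
                 (ℕ.≤-reflexive (ℕ.+-comm ((suc p ℕ.+ i) ℕ.* suc n) n))))

refined≤riemann+ : ∀ m p n → refined m p n ℚ.≤ riemann m p ℚ.+ unit p
refined≤riemann+ m p n = begin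
  refined m p n                              ≡⟨ refined≡blocks m p n ⟩
  blocks m p n                               ≤⟨ ∑-mono K (λ i _ → block i) ⟩
  ∑ K f                                      ≡⟨ ℚ.+-identityʳ (∑ K f) ⟨
  ∑ K f ℚ.+ 0ℚ                               ≤⟨ ℚ.+-monoʳ-≤ (∑ K f) (unit-nonNegative (p ℕ.+ K)) ⟩
  ∑ K f ℚ.+ f K                              ≡⟨ ∑-shift K f ⟩
  unit (p ℕ.+ 0) ℚ.+ riemann m p                ≡⟨ ℚ.+-comm (unit (p ℕ.+ 0)) (riemann m p) ⟩
  riemann m p ℚ.+ unit (p ℕ.+ 0)                ≡⟨ cong (λ q → riemann m p ℚ.+ unit q) (ℕ.+-identityʳ p) ⟩
  riemann m p ℚ.+ unit p                        ∎
  where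
  open ℚ.≤-Reasoning
  K : ℕ
  K = (m ∸ 1) ℕ.* suc p
  f : ℕ → ℚ
  f i = unit (p ℕ.+ i)
  block : ∀ i → ∑ (suc n) (λ j → unit ((suc p ℕ.+ i) ℕ.* suc n ℕ.+ j)) ℚ.≤ f i
  block i = ℚ.≤-trans
    (∑-mono (suc n) λ j _ → unit-antitone
      (ℕ.≤-trans (ℕ.n≤1+n _) (ℕ.m≤m+n ((suc p ℕ.+ i) ℕ.* suc n) j)))
    (ℚ.≤-reflexive (∑-block n (p ℕ.+ i)))

∣-∣≤ : ∀ {a b δ} → a ℚ.≤ b ℚ.+ δ → b ℚ.≤ a ℚ.+ δ → ∣ a ℚ.- b ∣ ℚ.≤ δ
∣-∣≤ {a} {b} {δ} a≤b+δ b≤a+δ with ℚ.∣p∣≡p∨∣p∣≡-p (a ℚ.- b)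
... | inj₁ eq rewrite eq = ℚ.≤-trans (ℚ.+-monoˡ-≤ (ℚ.- b) a≤b+δ) (ℚ.≤-reflexive (cancel b δ))
  where
  open ℚ.+-*-Solver
  cancel : ∀ b δ → b ℚ.+ δ ℚ.- b ≡ δ
  cancel = solve 2 (λ b δ → b :+ δ :- b := δ) refl
... | inj₂ eq rewrite eq = ℚ.≤-trans (ℚ.≤-reflexive (swap a b))
    (ℚ.≤-trans (ℚ.+-monoˡ-≤ (ℚ.- a) b≤a+δ) (ℚ.≤-reflexive (cancel a δ)))
  where
  open ℚ.+-*-Solver
  cancel : ∀ b δ → b ℚ.+ δ ℚ.- b ≡ δ
  cancel = solve 2 (λ b δ → b :+ δ :- b := δ) refl
  swap : ∀ a b → ℚ.- (a ℚ.- b) ≡ b ℚ.- a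
  swap = solve 2 (λ a b → :- (a :- b) := b :- a) refl

riemann≤riemann+ : ∀ m p n → riemann m p ℚ.≤ riemann m n ℚ.+ unit n
riemann≤riemann+ m p n = begin
  riemann m p            ≤⟨ riemann≤refined m p n ⟩
  refined m p n          ≡⟨ refined-comm m p n ⟩
  refined m n p          ≤⟨ refined≤riemann+ m n p ⟩
  riemann m n ℚ.+ unit n    ∎
  where open ℚ.≤-Reasoning

-- The logarithm ∫₁ᵐ dt/t for m ≥ 1; ln 0 takes the junk value 0.

ln : ℕ → ℝ
ln m .seq = riemann m
ln m .cauchy δ 0<δ = proj₁ K , λ p n K≤p K≤n →
  ∣-∣≤ (close p n K≤n) (close n p K≤p)
  where
  K : ∃[ K ] unit K ℚ.≤ δ
  K = unit-small δ 0<δ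

  close : ∀ p n → proj₁ K ℕ.≤ n → riemann m p ℚ.≤ riemann m n ℚ.+ δ
  close p n K≤n = ℚ.≤-trans (riemann≤riemann+ m p n)
    (ℚ.+-monoʳ-≤ (riemann m n) (ℚ.≤-trans (unit-antitone K≤n) (proj₂ K)))

{-# OPTIONS --safe #-}
module Submission where

-- A graph on n vertices is a tree exactly when it is connected with n − 1 edges, and connected
-- graphs have at least n − 1 edges. Let t count the spanning trees of Gₙ and s the spanning
-- subgraphs that become trees when the edge XY is added. In a spanning tree of Gₙ₊₁ every copy
-- of Gₙ carries a subgraph of one of these two kinds: collapsing the rest of the graph onto
-- the edge XY bounds the number of edges in each copy from below, replacing each copy by an edge
-- or a non-edge leaves a connected graph on X, Y, a, b, and the total number of edges forces
-- equality everywhere. So the counts for Gₙ₊₁ are sums of t^i s^(4−i) over the spanning trees of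
-- K₄ − XY and over those of K₄ through XY; both sums have 8 terms, hence t = s = 2^(4ⁿ−1).
--
-- For the limit, ln (ab) and ln a + ln b have Riemann sums that differ only in the mesh of the
-- last one, so ln 2^m is close to m ln 2, where m = 4ⁿ − 1 = 3κ and |V(Gₙ)| = 2κ + 2.

open import Defs
import Algebra.Properties.CommutativeSemigroup as CommutativeSemigroup
open import Data.Bool.Base using (Bool; true; false; if_then_else_; not)
open import Data.Empty using (⊥)
open import Data.Fin.Base as Fin using (Fin; zero; suc; _↑ˡ_; splitAt; remQuot; combine)
open import Data.Fin.Patterns using (0F; 1F; 2F; 3F)
import Data.Fin.Properties as Fin
open import Data.Integer.Base as ℤ using (+_; 0ℤ; 1ℤ)
import Data.Integer.Properties as ℤ
import Data.Integer.Tactic.RingSolver as ℤ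
open import Data.List.Base as List
  using (List; []; _∷_; _++_; map; concatMap; foldr; filter; length; allFin; deduplicate; removeAt)
open import Data.List.Membership.Propositional using (_∈_; find; lose)
open import Data.List.Membership.Propositional.Properties
  using (∈-allFin; ∈-lookup; ∈-++⁺ˡ; ∈-++⁺ʳ; ∈-++⁻; ∈-map⁺; ∈-map⁻; ∈-concatMap⁺; ∈-concatMap⁻)
import Data.List.Properties as List
open import Data.List.Relation.Unary.All as All using ([]; _∷_)
import Data.List.Relation.Unary.All.Properties as All
open import Data.List.Relation.Unary.AllPairs as AllPairs using (AllPairs; []; _∷_)
open import Data.List.Relation.Unary.Any as Any using (Any; here; there; any?)
import Data.List.Relation.Unary.Any.Properties as Any
import Data.List.Relation.Unary.Unique.DecSetoid.Properties as DecSetoidUnique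
open import Data.Nat.Base as ℕ using (ℕ; zero; suc; z≤n; s≤s; _∸_; _^_)
open import Data.Nat.DivMod using () renaming (_/_ to _div_)
import Data.Nat.DivMod as ℕ
open import Data.Nat.ListAction using (sum)
open import Data.Nat.ListAction.Properties using (sum-++)
import Data.Nat.Properties as ℕ
open import Data.Nat.Tactic.RingSolver using (solve-∀)
open import Data.Product.Base using (_×_; _,_; ∃-syntax; proj₁; proj₂; map₂)
open import Data.Rational.Base as ℚ using (ℚ; 0ℚ; 1ℚ; ½; _/_; ∣_∣)
import Data.Rational.Properties as ℚ
import Data.Rational.Solver as ℚ
import Data.Rational.Unnormalised.Base as ℚᵘ
import Data.Rational.Unnormalised.Properties as ℚᵘ
open import Data.Sum.Base as Sum using (_⊎_; inj₁; inj₂; [_,_]′)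
open import Data.Vec.Base as Vec using (Vec; []; _∷_; _∷ʳ_)
import Data.Vec.Membership.Propositional as Vec
import Data.Vec.Membership.Propositional.Properties as Vec
import Data.Vec.Properties as Vec
open import Data.Vec.Relation.Unary.All as VecAll using ([]; _∷_)
import Data.Vec.Relation.Unary.All.Properties as VecAll
open import Data.Vec.Relation.Unary.AllPairs using ([]; _∷_)
open import Data.Vec.Relation.Unary.Any as VecAny using (here; there)
open import Data.Vec.Relation.Unary.Unique.Propositional using (Unique)
import Data.Vec.Relation.Unary.Unique.Propositional.Properties as Unique
open import Function.Base using (_∘_; id)
open import Function.Bundles using (mk⇔)
open import Relation.Binary.Bundles using (DecSetoid)
open import Relation.Binary.Construct.Closure.Equivalence as Eq using ()
open import Relation.Binary.Construct.Closure.ReflexiveTransitive using (ε; _◅_; _◅◅_)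
open import Relation.Binary.Construct.Closure.Symmetric using (fwd; bwd)
open import Relation.Binary.PropositionalEquality
  using (_≡_; _≢_; refl; sym; trans; cong; cong₂; subst; subst₂; module ≡-Reasoning)
open import Relation.Nullary.Decidable
  using (Dec; yes; no; does; True; toWitness; dec-true; dec-false; does-⇔; _×-dec_)
open import Relation.Nullary.Negation using (¬_; contradiction)
import Relation.Unary as U

private
  variable
    n m k : ℕ
    A B P Q : Set

-- Trees and cycles

Edges : ℕ → Set
Edges n = List (Fin n × Fin n)

module _ {es : Edges n} where

  ~-sym : ∀ {u v} → EdgesConnect es u v → EdgesConnect es v u
  ~-sym = Eq.symmetric _

  edge : ∀ {u v} → (u , v) ∈ es → EdgesConnect es u v
  edge = Eq.return

  ~-map : ∀ {fs : Edges m} (f : Fin n → Fin m) →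
          (∀ {u v} → (u , v) ∈ es → EdgesConnect fs (f u) (f v)) →
          ∀ {u v} → EdgesConnect es u v → EdgesConnect fs (f u) (f v)
  ~-map = Eq.gfold (Eq.isEquivalence _)

module _ {a b : Fin n} {es : Edges n} where

  private
    Cases : Fin n → Fin n → Set
    Cases u v = EdgesConnect es u v ⊎ (EdgesConnect es u a × EdgesConnect es b v)
                                    ⊎ (EdgesConnect es u b × EdgesConnect es a v)

    prepend : ∀ {u w v} → EdgesConnect es u w → Cases w v → Cases u v
    prepend r = Sum.map (r ◅◅_) (Sum.map (λ (p , q) → r ◅◅ p , q) (λ (p , q) → r ◅◅ p , q))

  -- Repeated crossings of the new edge cancel or merge, so a walk needs it at most once, in one of
  -- its two directions.
  splitAtEdge : ∀ {u v} → EdgesConnect ((a , b) ∷ es) u v → Cases u v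
  splitAtEdge ε = inj₁ ε
  splitAtEdge (fwd (there e) ◅ p) = prepend (fwd e ◅ ε) (splitAtEdge p)
  splitAtEdge (bwd (there e) ◅ p) = prepend (bwd e ◅ ε) (splitAtEdge p)
  splitAtEdge (fwd (here refl) ◅ p) with splitAtEdge p
  ... | inj₁ q              = inj₂ (inj₁ (ε , q))
  ... | inj₂ (inj₁ (_ , q)) = inj₂ (inj₁ (ε , q))
  ... | inj₂ (inj₂ (_ , q)) = inj₁ q
  splitAtEdge (bwd (here refl) ◅ p) with splitAtEdge p
  ... | inj₁ q              = inj₂ (inj₂ (ε , q))
  ... | inj₂ (inj₁ (_ , q)) = inj₁ q
  ... | inj₂ (inj₂ (_ , q)) = inj₂ (inj₂ (ε , q))

-- `R` meets every component. Deleting an edge splits at most one component, and adding one endpoint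
-- of the edge to `R` makes up for it; with no edges left, every vertex is in `R`.
vertices≤cover+edges : ∀ (es : Edges n) R → (∀ u → Any (EdgesConnect es u) R) →
                       n ℕ.≤ length R ℕ.+ length es
vertices≤cover+edges [] R cover =
  ℕ.≤-trans (Fin.injective⇒≤ {f = λ u → Any.index (cover u)} injective) (ℕ.m≤m+n _ 0)
  where
  trivial : ∀ {u v} → EdgesConnect [] u v → u ≡ v
  trivial ε = refl
  trivial (fwd () ◅ _)
  trivial (bwd () ◅ _)
  injective : ∀ {u v} → Any.index (cover u) ≡ Any.index (cover v) → u ≡ v
  injective {u} {v} eq = trans (trivial (Any.lookup-index (cover u)))
    (trans (cong (List.lookup R) eq) (sym (trivial (Any.lookup-index (cover v)))))
vertices≤cover+edges {n} ((a , b) ∷ es) R cover =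
  ℕ.≤-trans (bound (representative a)) (ℕ.≤-reflexive (sym (ℕ.+-suc (length R) (length es))))
  where
  representative : ∀ u → ∃[ r ] r ∈ R × EdgesConnect ((a , b) ∷ es) u r
  representative u = find (cover u)

  -- `s` is the endpoint that still reaches a member of `R` after the deletion; the other endpoint
  -- `t` represents the part that was cut off.
  cover′ : ∀ s t → (∀ {u v} → EdgesConnect ((a , b) ∷ es) u v →
                      EdgesConnect es u v ⊎ (EdgesConnect es u s × EdgesConnect es t v)
                                          ⊎ (EdgesConnect es u t × EdgesConnect es s v)) →
           ∀ {r} → r ∈ R → EdgesConnect es s r → ∀ u → Any (EdgesConnect es u) (t ∷ R)
  cover′ s t split r∈R s~r u with representative u
  ... | r′ , r′∈R , u~r′ with split u~r′
  ...   | inj₁ p              = there (lose r′∈R p)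
  ...   | inj₂ (inj₁ (p , _)) = there (lose r∈R (p ◅◅ s~r))
  ...   | inj₂ (inj₂ (p , _)) = here p

  viaA : ∀ {r} → r ∈ R → EdgesConnect es a r → n ℕ.≤ suc (length R ℕ.+ length es)
  viaA r∈R a~r = vertices≤cover+edges es (b ∷ R) (cover′ a b splitAtEdge r∈R a~r)

  bound : ∃[ r ] r ∈ R × EdgesConnect ((a , b) ∷ es) a r → n ℕ.≤ suc (length R ℕ.+ length es)
  bound (r , r∈R , a~r) with splitAtEdge a~r
  ... | inj₁ p              = viaA r∈R p
  ... | inj₂ (inj₂ (_ , p)) = viaA r∈R p
  ... | inj₂ (inj₁ (_ , p)) =
    vertices≤cover+edges es (a ∷ R) (cover′ b a (Sum.map₂ Sum.swap ∘ splitAtEdge) r∈R p)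

connected⇒vertices≤ : ∀ {es : Edges (suc n)} → (∀ u v → EdgesConnect es u v) →
                      suc n ℕ.≤ suc (length es)
connected⇒vertices≤ {es = es} connected =
  vertices≤cover+edges es (0F ∷ []) (λ u → here (connected u 0F))

-- The final vertex of a walk is not listed among its vertices.
data Walk (H : Graph) : Fin (∣V∣ H) → Fin (∣V∣ H) → ∀ {l} →
                        Vec (Fin (∣V∣ H)) l → Vec (Fin (∣E∣ H)) l → Set where
  []  : ∀ {v} → Walk H v v [] []
  _∷_ : ∀ {u v w e l} {vs : Vec _ l} {es} →
        Joins H e u w → Walk H w v vs es → Walk H u v (u ∷ vs) (e ∷ es)

-- Only vertices are required to be distinct; distinct edges follow. The endpoint `v` is added to
-- the condition because `visited` omits it.
record Path (H : Graph) (u v : Fin (∣V∣ H)) : Set where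
  constructor path
  field
    {len}     : ℕ
    {visited} : Vec (Fin (∣V∣ H)) len
    {used}    : Vec (Fin (∣E∣ H)) len
    walk      : Walk H u v visited used
    simple    : Unique (v ∷ visited)

-- `vs ∷ʳ v` is `rotate (v ∷ vs)`, the sequence of successors in `IsCycle`, so a walk that leads
-- back to the tail of a further edge closes up to a cycle.
walk-joins : ∀ {H u v l} {vs : Vec _ l} {es} → Walk H u v vs es →
             (Vec.lookup (vs ∷ʳ v) zero ≡ u) ×
             (∀ i → Joins H (Vec.lookup es i) (Vec.lookup vs i) (Vec.lookup (vs ∷ʳ v) (suc i)))
walk-joins [] = refl , λ ()
walk-joins {H} (j ∷ p) = refl , λ
  { zero    → subst (Joins H _ _) (sym (proj₁ (walk-joins p))) j
  ; (suc i) → proj₂ (walk-joins p) i }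

joins-unique : ∀ {H e u v w x} → Joins H e u v → Joins H e w x → (u ≡ w) ⊎ (u ≡ x)
joins-unique (inj₁ p) (inj₁ q) with refl ← trans (sym p) q = inj₁ refl
joins-unique (inj₁ p) (inj₂ q) with refl ← trans (sym p) q = inj₂ refl
joins-unique (inj₂ p) (inj₁ q) with refl ← trans (sym p) q = inj₂ refl
joins-unique (inj₂ p) (inj₂ q) with refl ← trans (sym p) q = inj₁ refl

source∈walk : ∀ {H u v l} {vs : Vec _ l} {es} → Walk H u v vs es → u Vec.∈ (v ∷ vs)
source∈walk []      = here refl
source∈walk (_ ∷ _) = there (here refl)

-- Both ends of every edge of a walk lie on the walk.
avoided⇒unused : ∀ {H e u w x v l} {vs : Vec _ l} {es} → Joins H e u w → ¬ (u Vec.∈ (v ∷ vs)) →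
                 Walk H x v vs es → VecAll.All (e ≢_) es
avoided⇒unused j u∉ [] = []
avoided⇒unused {H} {v = v} j u∉ (_∷_ {vs = vs} k p) =
  (λ { refl → case (joins-unique {H} j k) }) ∷
  avoided⇒unused {H} j (λ { (here eq) → u∉ (here eq) ; (there i) → u∉ (there (there i)) }) p
  where
  case : _ → _
  case (inj₁ refl) = u∉ (there (here refl))
  case (inj₂ refl) with source∈walk p
  ... | here eq = u∉ (here eq)
  ... | there i = u∉ (there (there i))

dropSecond : ∀ {l} {v w : A} {vs : Vec A l} → Unique (v ∷ w ∷ vs) → Unique (v ∷ vs)
dropSecond ((_ ∷ d) ∷ _ ∷ ds) = d ∷ ds

-- A vertex never reappears once left, so neither does the edge used to leave it. Including the
-- endpoint rules out going back and forth along one edge.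
path-edges-unique : ∀ {H u v l} {vs : Vec _ l} {es} → Walk H u v vs es → Unique (v ∷ vs) → Unique es
path-edges-unique [] _ = []
path-edges-unique {H} (j ∷ p) u@((v≢u ∷ _) ∷ u≢vs ∷ _) =
  avoided⇒unused {H} j (λ { (here refl) → v≢u refl ; (there i) → VecAll.lookup u≢vs i refl }) p
  ∷ path-edges-unique p (dropSecond u)

shortcut : ∀ {H w v u l} {vs : Vec _ l} {es} → Walk H w v vs es → Unique (v ∷ vs) →
           u Vec.∈ vs → Path H u v
shortcut p d (here refl) with p
... | j ∷ q = path (j ∷ q) d
shortcut (_ ∷ p) d (there i) = shortcut p (dropSecond d) i

-- Loop erasure: if `u` is already on the path, the path is cut at `u` instead of being extended.
prependStep : ∀ {H e u w v} → Joins H e u w → Path H w v → Path H u v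
prependStep {H} {e} {u} {w} {v} j (path {visited = vs} p d) with u Fin.≟ v | VecAny.any? (u Fin.≟_) vs
... | yes refl | _     = path [] ([] ∷ [])
... | no u≢v   | yes i = shortcut p d i
... | no u≢v   | no u∉ with d
...   | d₀ ∷ ds = path (j ∷ p) (((u≢v ∘ sym) ∷ d₀) ∷ VecAll.lookup⁻ (λ i eq → u∉ (subst (Vec._∈ vs) (sym eq) (Vec.∈-lookup i vs))) ∷ ds)

connects⇒path : ∀ {H u v} → Connects H u v → Path H u v
connects⇒path ε = path [] ([] ∷ [])
connects⇒path {H} (fwd e ◅ p) =
  prependStep {H} {Any.index e} (inj₁ (sym (Any.lookup-index e))) (connects⇒path p)
connects⇒path {H} (bwd e ◅ p) =
  prependStep {H} {Any.index e} (inj₂ (sym (Any.lookup-index e))) (connects⇒path p)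

-- The simple path from `b` back to `a` uses only old edges, so the new edge completes it to a
-- cycle; for `a` equal to `b` this is a loop.
joined⇒cycle : ∀ {es : Edges n} {a b} → EdgesConnect es a b → HasCycle (graph n ((a , b) ∷ es))
joined⇒cycle {n} {es} {a} {b} a~b with connects⇒path {graph n es} (~-sym a~b)
... | path {visited = vs} {used = used} p d =
  _ , a ∷ vs , zero ∷ Vec.map suc used , d , zero∉ ∷ Unique.map⁺ Fin.suc-injective (path-edges-unique p d) ,
  λ { zero → inj₁ (cong (a ,_) (sym (proj₁ (walk-joins p))))
    ; (suc i) → subst (λ e → Joins (graph n ((a , b) ∷ es)) e _ _)
                      (sym (Vec.lookup-map i suc used)) (proj₂ (walk-joins p) i) }
  where
  zero∉ : VecAll.All (zero ≢_) (Vec.map suc used)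
  zero∉ = VecAll.map⁺ (VecAll.universal (λ _ ()) used)

hasCycle-∷ : ∀ {es : Edges n} {e} → HasCycle (graph n es) → HasCycle (graph n (e ∷ es))
hasCycle-∷ {n} {es} {e} (l , vs , used , d , d′ , joins) =
  l , vs , Vec.map suc used , d , Unique.map⁺ Fin.suc-injective d′ ,
  λ i → subst (λ f → Joins (graph n (e ∷ es)) f _ _) (sym (Vec.lookup-map i suc used)) (joins i)

pairwise : ∀ {R : A → A → Set} {xs x y} → AllPairs R xs → x ∈ xs → y ∈ xs → x ≡ y ⊎ R x y ⊎ R y x
pairwise _        (here refl) (here refl) = inj₁ refl
pairwise (r ∷ _)  (here refl) (there j)   = inj₂ (inj₁ (All.lookup r j))
pairwise (r ∷ _)  (there i)   (here refl) = inj₂ (inj₂ (All.lookup r i))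
pairwise (_ ∷ rs) (there i)   (there j)   = pairwise rs i j

unique⇒length≤ : ∀ {R : List (Fin n)} → AllPairs _≢_ R → length R ℕ.≤ n
unique⇒length≤ {R = R} d = Fin.injective⇒≤ {f = List.lookup R} (injective d)
  where
  injective : ∀ {R : List (Fin n)} → AllPairs _≢_ R → ∀ {i j} → List.lookup R i ≡ List.lookup R j → i ≡ j
  injective (x≢ ∷ d) {zero}  {zero}  _  = refl
  injective (x≢ ∷ d) {zero}  {suc j} eq = contradiction eq (All.lookup x≢ (∈-lookup j))
  injective (x≢ ∷ d) {suc i} {zero}  eq = contradiction (sym eq) (All.lookup x≢ (∈-lookup i))
  injective (x≢ ∷ d) {suc i} {suc j} eq = cong suc (injective d eq)

-- The counterpart of `vertices≤cover+edges`: `R` has at most one vertex in each component. Deleting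
-- an edge of a forest separates its ends, so one of them can join `R`.
acyclic⇒independent+edges≤ : ∀ (es : Edges n) R → ¬ HasCycle (graph n es) →
  AllPairs (λ u v → ¬ EdgesConnect es u v) R → length R ℕ.+ length es ℕ.≤ n
acyclic⇒independent+edges≤ [] R _ indep rewrite ℕ.+-identityʳ (length R) =
  unique⇒length≤ (AllPairs.map (λ { ≁ refl → ≁ ε }) indep)
acyclic⇒independent+edges≤ {n} ((a , b) ∷ es) R acyclic indep =
  ℕ.≤-trans (ℕ.≤-reflexive (ℕ.+-suc (length R) (length es))) (bound (any? (edgesConnect? es a) R))
  where
  indep′ : AllPairs (λ u v → ¬ EdgesConnect es u v) R
  indep′ = AllPairs.map (_∘ Eq.map there) indep

  extend : ∀ c → ¬ Any (EdgesConnect es c) R → suc (length R ℕ.+ length es) ℕ.≤ n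
  extend c c≁ = acyclic⇒independent+edges≤ es (c ∷ R) (acyclic ∘ hasCycle-∷)
                  (All.¬Any⇒All¬ R c≁ ∷ indep′)

  bound : Dec (Any (EdgesConnect es a) R) → suc (length R ℕ.+ length es) ℕ.≤ n
  bound (no a≁)  = extend a a≁
  bound (yes a~) = extend b λ b~ → clash (find a~) (find b~)
    where
    -- If both ends reached `R`, then a common member would close a cycle with the edge, and two
    -- different members would be connected through it.
    clash : (∃[ r ] r ∈ R × EdgesConnect es a r) → (∃[ s ] s ∈ R × EdgesConnect es b s) → ⊥
    clash (r , r∈R , a~r) (s , s∈R , b~s) with pairwise indep r∈R s∈R
    ... | inj₁ refl      = acyclic (joined⇒cycle (a~r ◅◅ ~-sym b~s))
    ... | inj₂ (inj₁ r≁s) = r≁s (~-sym (Eq.map there a~r) ◅◅ edge (here refl) ◅◅ Eq.map there b~s)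
    ... | inj₂ (inj₂ s≁r) = s≁r (~-sym (Eq.map there b~s) ◅◅ bwd (here refl) ◅ Eq.map there a~r)

∈-removeAt : ∀ (xs : List A) {i j} → i ≢ j → List.lookup xs j ∈ removeAt xs i
∈-removeAt (x ∷ xs) {zero}  {zero}  i≢j = contradiction refl i≢j
∈-removeAt (x ∷ xs) {zero}  {suc j} i≢j = ∈-lookup j
∈-removeAt (x ∷ xs) {suc i} {zero}  i≢j = here refl
∈-removeAt (x ∷ xs) {suc i} {suc j} i≢j = there (∈-removeAt xs (i≢j ∘ cong suc))

joins⇒connects : ∀ {es fs : Edges n} {e u v} → List.lookup es e ∈ fs → Joins (graph n es) e u v →
                 EdgesConnect fs u v
joins⇒connects {fs = fs} e∈ (inj₁ eq) = fwd (subst (_∈ fs) eq e∈) ◅ ε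
joins⇒connects {fs = fs} e∈ (inj₂ eq) = bwd (subst (_∈ fs) eq e∈) ◅ ε

joins⇒connected : ∀ {es fs : Edges n} {l} (xs : Vec (Fin n) l) (ds : Vec (Fin (length es)) l) x →
  VecAll.All (λ d → List.lookup es d ∈ fs) ds →
  (∀ i → Joins (graph n es) (Vec.lookup ds i) (Vec.lookup xs i) (Vec.lookup (xs ∷ʳ x) (suc i))) →
  EdgesConnect fs (Vec.lookup (xs ∷ʳ x) zero) x
joins⇒connected [] [] x _ _ = ε
joins⇒connected {es = es} (y ∷ xs) (d ∷ ds) x (d∈ ∷ ds∈) joins =
  joins⇒connects {es = es} d∈ (joins zero) ◅◅ joins⇒connected {es = es} xs ds x ds∈ (joins ∘ suc)

-- The first edge of the cycle can be deleted: the remaining cycle edges form a detour, so what is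
-- left still spans and obeys the bound for connected graphs.
connected∧cycle⇒vertices≤edges : ∀ {es : Edges (suc n)} → (∀ u v → EdgesConnect es u v) →
                                 HasCycle (graph (suc n) es) → suc n ℕ.≤ length es
connected∧cycle⇒vertices≤edges {n} {es} connected (l , x ∷ xs , d ∷ ds , _ , d≢ ∷ _ , joins) =
  ℕ.≤-trans (connected⇒vertices≤ {es = rest} λ u v → ~-map id reroute (connected u v))
            (ℕ.≤-reflexive (sym (List.length-removeAt′ es d)))
  where
  rest : Edges (suc n)
  rest = removeAt es d

  around : EdgesConnect rest (Vec.lookup (xs ∷ʳ x) zero) x
  around = joins⇒connected {es = es} xs ds x (VecAll.map (∈-removeAt es) d≢) (joins ∘ suc)

  detour : ∀ {u v} → List.lookup es d ≡ (u , v) → EdgesConnect rest u v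
  detour eq with joins zero
  ... | inj₁ eq′ with refl ← trans (sym eq) eq′ = ~-sym around
  ... | inj₂ eq′ with refl ← trans (sym eq) eq′ = around

  -- Positions are compared rather than vertex pairs, since a parallel copy of the deleted edge
  -- survives.
  reroute : ∀ {u v} → (u , v) ∈ es → EdgesConnect rest u v
  reroute e with Any.index e Fin.≟ d
  ... | yes refl = detour (sym (Any.lookup-index e))
  ... | no e≢d   = edge (subst (_∈ rest) (sym (Any.lookup-index e)) (∈-removeAt es (e≢d ∘ sym)))

Spans : Edges n → Set
Spans es = ∀ u v → EdgesConnect es u v

-- The edge count replaces acyclicity because it is additive under gluing.
SpanningTree : Edges n → Set
SpanningTree {n} es = Spans es × suc (length es) ≡ n

isTree⇒spanningTree : ∀ {es : Edges (suc n)} → IsTree (graph (suc n) es) → SpanningTree es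
isTree⇒spanningTree {es = es} (connected , acyclic) = connected ,
  ℕ.≤-antisym (acyclic⇒independent+edges≤ es (0F ∷ []) acyclic ([] ∷ []))
              (connected⇒vertices≤ connected)

spanningTree⇒isTree : ∀ {es : Edges (suc n)} → SpanningTree es → IsTree (graph (suc n) es)
spanningTree⇒isTree {es = es} (connected , eq) = connected , λ cycle →
  ℕ.1+n≰n (ℕ.≤-trans (ℕ.≤-reflexive eq) (connected∧cycle⇒vertices≤edges connected cycle))

-- Number of components and connectedness

module _ (H : Graph) where

  private
    connectsSetoid : DecSetoid _ _
    connectsSetoid = record
      { isDecEquivalence = record { isEquivalence = Eq.isEquivalence _ ; _≟_ = connects? H } }

  spans⇒components≤1 : Connected H → components H ℕ.≤ 1
  spans⇒components≤1 connected = all-related (DecSetoidUnique.deduplicate-! connectsSetoid (allFin (∣V∣ H)))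
    where
    all-related : ∀ {xs} → AllPairs (λ u v → ¬ Connects H u v) xs → length xs ℕ.≤ 1
    all-related []                  = z≤n
    all-related (_ ∷ [])            = s≤s z≤n
    all-related ((≁ ∷ _) ∷ (_ ∷ _)) = contradiction (connected _ _) ≁

  private
    representative : ∀ u → Any (Connects H u) (deduplicate (connects? H) (allFin (∣V∣ H)))
    representative u = Any.deduplicate⁺ (connects? H) (λ w~v u~v → u~v ◅◅ ~-sym w~v)
                                        (lose (∈-allFin u) ε)

  components≤1⇒spans : components H ℕ.≤ 1 → Connected H
  components≤1⇒spans k≤1 u v = same k≤1 (representative u) (representative v)
    where
    same : ∀ {xs} → length xs ℕ.≤ 1 → Any (Connects H u) xs → Any (Connects H v) xs → Connects H u v
    same _ (here p) (here q) = p ◅◅ ~-sym q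
    same {_ ∷ _ ∷ _} (s≤s ()) (there _) _
    same {_ ∷ _ ∷ _} (s≤s ()) _ (there _)

  1≤components : Fin (∣V∣ H) → 1 ℕ.≤ components H
  1≤components u with deduplicate (connects? H) (allFin (∣V∣ H)) | representative u
  ... | _ ∷ _ | _ = s≤s z≤n

-- Counting spanning trees

⟦_⟧ : Dec P → ℕ
⟦ p? ⟧ = if does p? then 1 else 0

⟦⟧-cong : (p? : Dec P) (q? : Dec Q) → (P → Q) → (Q → P) → ⟦ p? ⟧ ≡ ⟦ q? ⟧
⟦⟧-cong (yes _) (yes _) _ _ = refl
⟦⟧-cong (no _)  (no _)  _ _ = refl
⟦⟧-cong (yes p) (no ¬q) f _ = contradiction (f p) ¬q
⟦⟧-cong (no ¬p) (yes q) _ g = contradiction (g q) ¬p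

-- Recursion on the list, instead of a sum over `sublists`, lets the sum over a concatenation split
-- into iterated sums.
∑⊆ : (List A → ℕ) → List A → ℕ
∑⊆ f []       = f []
∑⊆ f (x ∷ xs) = ∑⊆ (f ∘ (x ∷_)) xs ℕ.+ ∑⊆ f xs

∑⊆-cong : ∀ {f g : List A → ℕ} → (∀ h → f h ≡ g h) → ∀ xs → ∑⊆ f xs ≡ ∑⊆ g xs
∑⊆-cong f≡g []       = f≡g []
∑⊆-cong f≡g (x ∷ xs) = cong₂ ℕ._+_ (∑⊆-cong (f≡g ∘ (x ∷_)) xs) (∑⊆-cong f≡g xs)

∑⊆-++ : ∀ (f : List A → ℕ) xs ys → ∑⊆ f (xs ++ ys) ≡ ∑⊆ (λ h → ∑⊆ (λ k → f (h ++ k)) ys) xs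
∑⊆-++ f []       ys = refl
∑⊆-++ f (x ∷ xs) ys = cong₂ ℕ._+_ (∑⊆-++ (f ∘ (x ∷_)) xs ys) (∑⊆-++ f xs ys)

∑⊆-map : ∀ (f : List B → ℕ) (g : A → B) xs → ∑⊆ f (map g xs) ≡ ∑⊆ (f ∘ map g) xs
∑⊆-map f g []       = refl
∑⊆-map f g (x ∷ xs) = cong₂ ℕ._+_ (∑⊆-map (f ∘ (g x ∷_)) g xs) (∑⊆-map f g xs)

∑⊆-* : ∀ c (f : List A → ℕ) xs → ∑⊆ (λ h → c ℕ.* f h) xs ≡ c ℕ.* ∑⊆ f xs
∑⊆-* c f []       = refl
∑⊆-* c f (x ∷ xs) = trans (cong₂ ℕ._+_ (∑⊆-* c _ xs) (∑⊆-* c f xs)) (sym (ℕ.*-distribˡ-+ c _ _))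

∑⊆-+ : ∀ (f g : List A → ℕ) xs → ∑⊆ (λ h → f h ℕ.+ g h) xs ≡ ∑⊆ f xs ℕ.+ ∑⊆ g xs
∑⊆-+ f g []       = refl
∑⊆-+ f g (x ∷ xs) = trans (cong₂ ℕ._+_ (∑⊆-+ (f ∘ (x ∷_)) (g ∘ (x ∷_)) xs) (∑⊆-+ f g xs))
                              (interchange (∑⊆ (f ∘ (x ∷_)) xs) _ _ _)
  where open CommutativeSemigroup ℕ.+-commutativeSemigroup

sum-sublists : ∀ (f : List A → ℕ) xs → sum (map f (sublists xs)) ≡ ∑⊆ f xs
sum-sublists f []       = ℕ.+-identityʳ (f [])
sum-sublists f (x ∷ xs) = trans (cong sum (List.map-++ f (map (x ∷_) (sublists xs)) (sublists xs)))
  (trans (sum-++ (map f (map (x ∷_) (sublists xs))) _)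
    (cong₂ ℕ._+_ (trans (cong sum (sym (List.map-∘ (sublists xs)))) (sum-sublists (f ∘ (x ∷_)) xs))
                 (sum-sublists f xs)))

length-filter : ∀ {P : B → Set} (P? : U.Decidable P) (g : A → B) xs →
                length (filter P? (map g xs)) ≡ sum (map (λ x → ⟦ P? (g x) ⟧) xs)
length-filter P? g []       = refl
length-filter P? g (x ∷ xs) with does (P? (g x))
... | true  = cong suc (length-filter P? g xs)
... | false = length-filter P? g xs

foldr-+ : ∀ {t : B → ℤ.ℤ} (g : A → B) (f : A → ℕ) → (∀ x → t (g x) ≡ + f x) →
          ∀ xs → foldr ℤ._+_ 0ℤ (map t (map g xs)) ≡ + sum (map f xs)
foldr-+ g f t≡f []       = refl
foldr-+ g f t≡f (x ∷ xs) = cong₂ ℤ._+_ (t≡f x) (foldr-+ g f t≡f xs)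

spanningTree? : ∀ (es : Edges n) → Dec (SpanningTree es)
spanningTree? {n} es = Fin.all? (λ u → Fin.all? (edgesConnect? es u)) ×-dec (suc (length es) ℕ.≟ n)

#trees : Edges n → ℕ
#trees = ∑⊆ (λ h → ⟦ spanningTree? h ⟧)

τ≡#trees : ∀ (es : Edges (suc n)) → τ (graph (suc n) es) ≡ #trees es
τ≡#trees es = trans (length-filter isTree? (graph _) (sublists es))
  (trans (sum-sublists _ es)
    (∑⊆-cong (λ h → ⟦⟧-cong (isTree? (graph _ h)) (spanningTree? h)
                              isTree⇒spanningTree spanningTree⇒isTree) es))

-- At (1,1) both bases are 0 and `0 ^ 0` is 1, so a subgraph contributes 1 exactly when both
-- exponents vanish: full rank means connected, and nullity 0 then fixes the number of edges.
tutte≡#trees : ∀ (es : Edges (2 ℕ.+ n)) → Spans es → tutte (graph (2 ℕ.+ n) es) 1ℤ 1ℤ ≡ + #trees es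
tutte≡#trees {n} es spans =
  trans (foldr-+ (graph _) (λ h → ⟦ spanningTree? h ⟧) (λ h → term≡ h (spanningTree? h)) (sublists es)) (cong +_ (sum-sublists _ es))
  where
  components≡1 : ∀ (h : Edges (2 ℕ.+ n)) → Spans h → components (graph _ h) ≡ 1
  components≡1 h connected =
    ℕ.≤-antisym (spans⇒components≤1 (graph _ h) connected) (1≤components (graph _ h) 0F)

  -- Truncated subtraction is harmless here: for k at least 2 the difference is at most `n`, below
  -- the required `suc n`.
  components≤1 : ∀ k → suc n ℕ.≤ 2 ℕ.+ n ∸ k → k ℕ.≤ 1
  components≤1 zero          _ = z≤n
  components≤1 (suc zero)    _ = s≤s z≤n
  components≤1 (suc (suc k)) le = contradiction (ℕ.≤-trans le (ℕ.m∸n≤m n k)) ℕ.1+n≰n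

  rank≡ : rank (graph _ es) ≡ suc n
  rank≡ = cong (2 ℕ.+ n ∸_) (components≡1 es spans)

  tree : ∀ h → rank (graph _ es) ∸ rank (graph (2 ℕ.+ n) h) ≡ 0 → nullity (graph (2 ℕ.+ n) h) ≡ 0 →
         SpanningTree h
  tree h r≡0 n≡0 = connected , ℕ.≤-antisym suc≤ (connected⇒vertices≤ connected)
    where
    k≤1 : components (graph _ h) ℕ.≤ 1
    k≤1 = components≤1 (components (graph _ h)) (ℕ.≤-trans (ℕ.≤-reflexive (sym rank≡)) (ℕ.m∸n≡0⇒m≤n r≡0))
    connected : Spans h
    connected = components≤1⇒spans (graph _ h) k≤1
    suc≤ : suc (length h) ℕ.≤ 2 ℕ.+ n
    suc≤ = ℕ.≤-trans (ℕ.≤-reflexive (trans (ℕ.+-comm 1 (length h))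
                       (cong (length h ℕ.+_) (sym (components≡1 h connected)))))
                     (ℕ.m∸n≡0⇒m≤n n≡0)

  rank-tree : ∀ h → SpanningTree h → rank (graph _ es) ∸ rank (graph (2 ℕ.+ n) h) ≡ 0
  rank-tree h (connected , _) =
    trans (cong₂ _∸_ rank≡ (cong (2 ℕ.+ n ∸_) (components≡1 h connected)))
          (ℕ.n∸n≡0 (suc n))

  nullity-tree : ∀ h → SpanningTree h → nullity (graph (2 ℕ.+ n) h) ≡ 0
  nullity-tree h (connected , eq) = trans
    (cong (_∸ (2 ℕ.+ n)) (trans (cong (length h ℕ.+_) (components≡1 h connected))
                                (trans (ℕ.+-comm (length h) 1) eq)))
    (ℕ.n∸n≡0 (2 ℕ.+ n))

  0^≡0 : ∀ k l → ¬ (k ≡ 0 × l ≡ 0) → 0ℤ ℤ.^ k ℤ.* 0ℤ ℤ.^ l ≡ 0ℤ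
  0^≡0 zero    zero    ≢ = contradiction (refl , refl) ≢
  0^≡0 zero    (suc l) _ = refl
  0^≡0 (suc k) l       _ = refl

  term≡ : ∀ h (d : Dec (SpanningTree h)) →
          0ℤ ℤ.^ (rank (graph _ es) ∸ rank (graph (2 ℕ.+ n) h)) ℤ.* 0ℤ ℤ.^ nullity (graph (2 ℕ.+ n) h)
          ≡ + ⟦ d ⟧
  term≡ h (yes t) = cong₂ (λ k l → 0ℤ ℤ.^ k ℤ.* 0ℤ ℤ.^ l) (rank-tree h t) (nullity-tree h t)
  term≡ h (no ¬t) = 0^≡0 _ _ (λ (r≡0 , n≡0) → ¬t (tree h r≡0 n≡0))

-- Gluing four copies

both : (A → B) → A × A → B × B
both f (u , v) = f u , f v

∑₄ : (Fin 4 → ℕ) → ℕ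
∑₄ f = f 0F ℕ.+ (f 1F ℕ.+ (f 2F ℕ.+ f 3F))

∑₄-cong : ∀ {f g} → (∀ i → f i ≡ g i) → ∑₄ f ≡ ∑₄ g
∑₄-cong f≡g = cong₂ ℕ._+_ (f≡g 0F) (cong₂ ℕ._+_ (f≡g 1F) (cong₂ ℕ._+_ (f≡g 2F) (f≡g 3F)))

∑₄-mono : ∀ {f g} → (∀ i → f i ℕ.≤ g i) → ∑₄ f ℕ.≤ ∑₄ g
∑₄-mono f≤g = ℕ.+-mono-≤ (f≤g 0F) (ℕ.+-mono-≤ (f≤g 1F) (ℕ.+-mono-≤ (f≤g 2F) (f≤g 3F)))

∑₄-+ : ∀ f g → ∑₄ (λ i → f i ℕ.+ g i) ≡ ∑₄ f ℕ.+ ∑₄ g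
∑₄-+ f g = rearrange (f 0F) (g 0F) (f 1F) (g 1F) (f 2F) (g 2F) (f 3F) (g 3F)
  where
  rearrange : ∀ a a′ b b′ c c′ d d′ → (a ℕ.+ a′) ℕ.+ ((b ℕ.+ b′) ℕ.+ ((c ℕ.+ c′) ℕ.+ (d ℕ.+ d′)))
              ≡ (a ℕ.+ (b ℕ.+ (c ℕ.+ d))) ℕ.+ (a′ ℕ.+ (b′ ℕ.+ (c′ ℕ.+ d′)))
  rearrange = solve-∀

tight : ∀ {a a′ b b′} → a ℕ.≤ a′ → b ℕ.≤ b′ → a′ ℕ.+ b′ ≡ a ℕ.+ b → a ≡ a′ × b ≡ b′
tight {a} {a′} {b} {b′} a≤ b≤ eq =
  ℕ.≤-antisym a≤ (ℕ.+-cancelʳ-≤ b _ _ (ℕ.≤-trans (ℕ.+-monoʳ-≤ a′ b≤) (ℕ.≤-reflexive eq))) ,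
  ℕ.≤-antisym b≤ (ℕ.+-cancelˡ-≤ a _ _ (ℕ.≤-trans (ℕ.+-monoˡ-≤ b′ a≤) (ℕ.≤-reflexive eq)))

tight₄ : ∀ {f g} → (∀ i → f i ℕ.≤ g i) → ∑₄ g ≡ ∑₄ f → ∀ i → f i ≡ g i
tight₄ {f} {g} f≤g eq =
  let p₀ , q₀ = tight (f≤g 0F) (ℕ.+-mono-≤ (f≤g 1F) (ℕ.+-mono-≤ (f≤g 2F) (f≤g 3F))) eq
      p₁ , q₁ = tight (f≤g 1F) (ℕ.+-mono-≤ (f≤g 2F) (f≤g 3F)) (sym q₀)
      p₂ , p₃ = tight (f≤g 2F) (f≤g 3F) (sym q₁)
  in λ { 0F → p₀ ; 1F → p₁ ; 2F → p₂ ; 3F → p₃ }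

-- `D` holds the edges outside the four copies: `ab` when it is kept, and `XY` when it is added. The
-- glued graph and its four-vertex skeleton both have this shape.
network : Edges n → (Fin 4 → Edges n) → Edges n
network D F = D ++ concatMap F (allFin 4)

length-network : ∀ (D : Edges n) F → length (network D F) ≡ length D ℕ.+ ∑₄ (length ∘ F)
length-network D F = trans (List.length-++ D) (cong (length D ℕ.+_) (length-concat₄))
  where
  length-concat₄ : length (concatMap F (allFin 4)) ≡ ∑₄ (length ∘ F)
  length-concat₄ = trans (List.length-++ (F 0F)) (cong (length (F 0F) ℕ.+_)
    (trans (List.length-++ (F 1F)) (cong (length (F 1F) ℕ.+_)
    (trans (List.length-++ (F 2F)) (cong (length (F 2F) ℕ.+_)
    (cong length (List.++-identityʳ (F 3F))))))))

module _ (D : Edges n) (F : Fin 4 → Edges n) where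

  network-elim : ∀ {e} → e ∈ network D F → e ∈ D ⊎ ∃[ i ] e ∈ F i
  network-elim e∈ =
    Sum.map₂ (λ e∈F → map₂ proj₂ (find (∈-concatMap⁻ F {xs = allFin 4} e∈F))) (∈-++⁻ D e∈)

  network-rigid : ∀ {e} → e ∈ D → e ∈ network D F
  network-rigid = ∈-++⁺ˡ

  network-block : ∀ {e} i → e ∈ F i → e ∈ network D F
  network-block i e∈ = ∈-++⁺ʳ D (∈-concatMap⁺ F (lose (∈-allFin i) e∈))

-- The places of `X` and `Y` of each copy. The four pairs form the 4-cycle `X a Y b`.
start end : Fin 4 → Fin 4
start 0F = 0F
start 1F = 0F
start 2F = 2F
start 3F = 3F
end 0F = 2F
end 1F = 3F
end 2F = 1F
end 3F = 1F

switch : (Fin 4 → Bool) → Fin 4 → Edges 4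
switch c i = if c i then (start i , end i) ∷ [] else []

skeleton : Edges 4 → (Fin 4 → Bool) → Edges 4
skeleton D c = network D (switch c)

module _ (D : Edges 4) (c : Fin 4 → Bool) where

  skeleton-map : ∀ {es : Edges m} (f : Fin 4 → Fin m) →
    (∀ {u v} → (u , v) ∈ D → EdgesConnect es (f u) (f v)) →
    (∀ i → c i ≡ true → EdgesConnect es (f (start i)) (f (end i))) →
    ∀ {u v} → EdgesConnect (skeleton D c) u v → EdgesConnect es (f u) (f v)
  skeleton-map {es = es} f onD onC = ~-map f step
    where
    onBlock : ∀ i b → c i ≡ b → ∀ {u v} → (u , v) ∈ (if b then (start i , end i) ∷ [] else []) →
              EdgesConnect es (f u) (f v)
    onBlock i true ci (here refl) = onC i ci
    step : ∀ {u v} → (u , v) ∈ skeleton D c → EdgesConnect es (f u) (f v)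
    step e∈ with network-elim D (switch c) e∈
    ... | inj₁ d∈       = onD d∈
    ... | inj₂ (i , b∈) = onBlock i (c i) refl b∈

  skeleton-edge : ∀ i → c i ≡ true → EdgesConnect (skeleton D c) (start i) (end i)
  skeleton-edge i ci = edge (network-block D (switch c) i
    (subst (λ b → (start i , end i) ∈ (if b then (start i , end i) ∷ [] else [])) (sym ci) (here refl)))

-- The possible images of everything outside a copy when the graph is retracted onto that copy.
data Terminal {k} : Fin (2 ℕ.+ k) → Set where
  X : Terminal 0F
  Y : Terminal 1F

terminals-connected : ∀ {es : Edges (2 ℕ.+ k)} {u v} → Terminal u → Terminal v →
                      EdgesConnect ((0F , 1F) ∷ es) u v
terminals-connected X X = ε
terminals-connected X Y = fwd (here refl) ◅ ε
terminals-connected Y X = bwd (here refl) ◅ ε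
terminals-connected Y Y = ε

terminal : ∀ {u : Fin (2 ℕ.+ k)} b → u ≡ (if b then 1F else 0F) → Terminal u
terminal true  refl = Y
terminal false refl = X

module Gluing (k : ℕ) where

  V : ℕ
  V = 2 ℕ.+ (2 ℕ.+ 4 ℕ.* k)

  outer : Fin 4 → Fin V
  outer w = w ↑ˡ (4 ℕ.* k)

  assembled : Edges 4 → (Fin 4 → Edges (2 ℕ.+ k)) → Edges V
  assembled D H = network (map (both outer) D) (λ i → map (both (place i)) (H i))

  place-start : ∀ i → place {k} i 0F ≡ outer (start i)
  place-start 0F = refl
  place-start 1F = refl
  place-start 2F = refl
  place-start 3F = refl

  place-end : ∀ i → place {k} i 1F ≡ outer (end i)
  place-end 0F = refl
  place-end 1F = refl
  place-end 2F = refl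
  place-end 3F = refl

  place-inner : ∀ i v → place {k} i (suc (suc v)) ≡ suc (suc (suc (suc (combine i v))))
  place-inner 0F v = refl
  place-inner 1F v = refl
  place-inner 2F v = refl
  place-inner 3F v = refl

  module _ {A : Set} (f : Fin 4 → A) (g : Fin 4 → Fin k → A) where

    abstract

      -- Maps out of the glued vertex set are given by their values on the outer vertices and on the
      -- inner vertices of each copy. Being abstract, the map is used only through the two equations
      -- below.
      onVertices : Fin V → A
      onVertices v = [ f , (λ x → g (proj₁ (remQuot {4} k x)) (proj₂ (remQuot {4} k x))) ]′ (splitAt 4 v)

      onVertices-outer : ∀ w → onVertices (outer w) ≡ f w
      onVertices-outer w = cong [ f , _ ]′ (Fin.splitAt-↑ˡ 4 w (4 ℕ.* k))

      onVertices-inner : ∀ i v → onVertices (place i (suc (suc v))) ≡ g i v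
      onVertices-inner i v = trans (cong onVertices (place-inner i v))
        (cong (λ p → g (proj₁ p) (proj₂ p)) (Fin.remQuot-combine {4} i v))

  data Vertex : Fin V → Set where
    isOuter : ∀ w → Vertex (outer w)
    isInner : ∀ i v → Vertex (place {k} i (suc (suc v)))

  vertex : ∀ v → Vertex v
  vertex 0F = isOuter 0F
  vertex 1F = isOuter 1F
  vertex 2F = isOuter 2F
  vertex 3F = isOuter 3F
  vertex (suc (suc (suc (suc x)))) =
    subst Vertex (trans (place-inner i v) (cong (λ x → suc (suc (suc (suc x)))) (Fin.combine-remQuot {4} k x)))
          (isInner i v)
    where
    i : Fin 4
    i = proj₁ (remQuot {4} k x)
    v : Fin k
    v = proj₂ (remQuot {4} k x)

  module _ (D : Edges 4) (H : Fin 4 → Edges (2 ℕ.+ k)) where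

    assembled-map : ∀ {es : Edges m} (f : Fin V → Fin m) →
      (∀ u v → (u , v) ∈ D → EdgesConnect es (f (outer u)) (f (outer v))) →
      (∀ i u v → (u , v) ∈ H i → EdgesConnect es (f (place i u)) (f (place i v))) →
      ∀ {u v} → EdgesConnect (assembled D H) u v → EdgesConnect es (f u) (f v)
    assembled-map {es = es} f onD onH = ~-map f step
      where
      step : ∀ {u v} → (u , v) ∈ assembled D H → EdgesConnect es (f u) (f v)
      step e∈ with network-elim (map (both outer) D) (λ i → map (both (place i)) (H i)) e∈
      ... | inj₁ e∈D with ∈-map⁻ (both outer) e∈D
      ...   | (u , v) , d∈ , refl = onD u v d∈
      step e∈ | inj₂ (i , e∈F) with ∈-map⁻ (both (place i)) e∈F
      ...   | (u , v) , h∈ , refl = onH i u v h∈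

    outer-edge : ∀ {u v} → (u , v) ∈ D → EdgesConnect (assembled D H) (outer u) (outer v)
    outer-edge d∈ = edge (network-rigid (map (both outer) D) (λ i → map (both (place i)) (H i))
                            (∈-map⁺ (both outer) d∈))

    place-connected : ∀ i {u v} → EdgesConnect (H i) u v →
                      EdgesConnect (assembled D H) (place i u) (place i v)
    place-connected i = ~-map (place i) λ h∈ →
      edge (network-block (map (both outer) D) (λ i → map (both (place i)) (H i)) i
              (∈-map⁺ (both (place i)) h∈))

  module Retraction (i : Fin 4) where

    onOuter : Fin 4 → Fin (2 ℕ.+ k)
    onOuter w = if does (w Fin.≟ end i) then 1F else 0F

    onInner : Fin 4 → Fin k → Fin (2 ℕ.+ k)
    onInner j v = if does (i Fin.≟ j) then suc (suc v) else 0F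

    retract : Fin V → Fin (2 ℕ.+ k)
    retract = onVertices onOuter onInner

    retract-outer : ∀ w → Terminal (retract (outer w))
    retract-outer w = terminal (does (w Fin.≟ end i)) (onVertices-outer onOuter onInner w)

    retract-place : ∀ v → retract (place i v) ≡ v
    retract-place 0F = trans (cong retract (place-start i))
      (trans (onVertices-outer onOuter onInner (start i)) (cong (if_then 1F else 0F) (start≢end i)))
      where
      start≢end : ∀ i → does (start i Fin.≟ end i) ≡ false
      start≢end 0F = refl
      start≢end 1F = refl
      start≢end 2F = refl
      start≢end 3F = refl
    retract-place 1F = trans (cong retract (place-end i))
      (trans (onVertices-outer onOuter onInner (end i))
             (cong (if_then 1F else 0F) (dec-true (end i Fin.≟ end i) refl)))
    retract-place (suc (suc v)) = trans (onVertices-inner onOuter onInner i v)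
      (cong (if_then suc (suc v) else 0F) (dec-true (i Fin.≟ i) refl))

    retract-other : ∀ {j} → i ≢ j → ∀ v → Terminal (retract (place {k} j v))
    retract-other {j} i≢j 0F = subst (λ u → Terminal (retract u)) (sym (place-start j)) (retract-outer (start j))
    retract-other {j} i≢j 1F = subst (λ u → Terminal (retract u)) (sym (place-end j)) (retract-outer (end j))
    retract-other {j} i≢j (suc (suc v)) = terminal false (trans (onVertices-inner onOuter onInner j v)
      (cong (if_then suc (suc v) else 0F) (dec-false (i Fin.≟ j) i≢j)))

    -- The retraction fixes copy `i` and sends every other edge to a pair of terminals, which the
    -- edge `XY` connects.
    spans-copy : ∀ D H → Spans (assembled D H) → Spans ((0F , 1F) ∷ H i)
    spans-copy D H spans u v = subst₂ (EdgesConnect _) (retract-place u) (retract-place v)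
      (assembled-map D H retract (λ u v _ → terminals-connected (retract-outer u) (retract-outer v)) onH
                     (spans (place i u) (place i v)))
      where
      onH : ∀ j u v → (u , v) ∈ H j → EdgesConnect ((0F , 1F) ∷ H i) (retract (place j u)) (retract (place j v))
      onH j u v h∈ with i Fin.≟ j
      ... | yes refl = subst₂ (EdgesConnect _) (sym (retract-place u)) (sym (retract-place v)) (edge (there h∈))
      ... | no i≢j   = terminals-connected (retract-other i≢j u) (retract-other i≢j v)

  module Collapse (D : Edges 4) (H : Fin 4 → Edges (2 ℕ.+ k)) where

    closed : Fin 4 → Bool
    closed i = does (edgesConnect? (H i) 0F 1F)

    -- Vertices connected to `X` inside the copy go to `start i`, all others to `end i`; hence both
    -- ends of an edge of `H i` are on the same side.
    side : Fin 4 → Fin (2 ℕ.+ k) → Fin 4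
    side i u = if does (edgesConnect? (H i) 0F u) then start i else end i

    collapse : Fin V → Fin 4
    collapse = onVertices id (λ i v → side i (suc (suc v)))

    collapse-outer : ∀ w → collapse (outer w) ≡ w
    collapse-outer = onVertices-outer id _

    -- The two can differ only at `Y`, which collapses to `end i` but is on the side of `start i` if
    -- the copy is closed; then the skeleton contains the edge between them.
    collapse~side : ∀ i u → EdgesConnect (skeleton D closed) (collapse (place i u)) (side i u)
    collapse~side i 0F = subst₂ (EdgesConnect _)
      (sym (trans (cong collapse (place-start i)) (collapse-outer (start i))))
      (cong (if_then start i else end i) (sym (dec-true (edgesConnect? (H i) 0F 0F) ε))) ε
    collapse~side i 1F = subst (λ w → EdgesConnect _ w (side i 1F))
      (sym (trans (cong collapse (place-end i)) (collapse-outer (end i)))) (fromEnd (closed i) refl)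
      where
      fromEnd : ∀ b → closed i ≡ b → EdgesConnect (skeleton D closed) (end i) (if b then start i else end i)
      fromEnd true  ci = ~-sym (skeleton-edge D closed i ci)
      fromEnd false ci = ε
    collapse~side i (suc (suc v)) =
      subst (λ w → EdgesConnect _ w (side i (suc (suc v)))) (sym (onVertices-inner id _ i v)) ε

    spans-skeleton : Spans (assembled D H) → Spans (skeleton D closed)
    spans-skeleton spans u v = subst₂ (EdgesConnect _) (collapse-outer u) (collapse-outer v)
      (assembled-map D H collapse onD onH (spans (outer u) (outer v)))
      where
      onD : ∀ u v → (u , v) ∈ D → EdgesConnect (skeleton D closed) (collapse (outer u)) (collapse (outer v))
      onD u v d∈ = subst₂ (EdgesConnect _) (sym (collapse-outer u)) (sym (collapse-outer v))
        (edge (network-rigid D (switch closed) d∈))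
      onH : ∀ i u v → (u , v) ∈ H i → EdgesConnect (skeleton D closed) (collapse (place i u)) (collapse (place i v))
      onH i u v h∈ = collapse~side i u ◅◅
        subst (λ w → EdgesConnect _ w _) (sym same) (~-sym (collapse~side i v))
        where
        same : side i u ≡ side i v
        same = cong (if_then start i else end i)
          (does-⇔ (mk⇔ (_◅◅ edge h∈) (_◅◅ ~-sym (edge h∈))) (edgesConnect? (H i) 0F u) (edgesConnect? (H i) 0F v))

  -- Every inner vertex reaches a terminal of its copy, and walks of the skeleton lift through the
  -- conducting copies.
  spans-assembled : ∀ D H c → Spans (skeleton D c) → (∀ i → Spans ((0F , 1F) ∷ H i)) →
                    (∀ i → c i ≡ true → EdgesConnect (H i) 0F 1F) → Spans (assembled D H)
  spans-assembled D H c skeleton-spans copies-span conducts u v =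
    let u′ , u~u′ = toOuter u (vertex u)
        v′ , v~v′ = toOuter v (vertex v)
    in u~u′ ◅◅ skeleton-map D c outer (outer-edge D H) onC (skeleton-spans u′ v′) ◅◅ ~-sym v~v′
    where
    toStart : ∀ i {u} → EdgesConnect (H i) u 0F → EdgesConnect (assembled D H) (place i u) (outer (start i))
    toStart i p = subst (EdgesConnect _ _) (place-start i) (place-connected D H i p)
    toEnd : ∀ i {u} → EdgesConnect (H i) u 1F → EdgesConnect (assembled D H) (place i u) (outer (end i))
    toEnd i p = subst (EdgesConnect _ _) (place-end i) (place-connected D H i p)
    onC : ∀ i → c i ≡ true → EdgesConnect (assembled D H) (outer (start i)) (outer (end i))
    onC i ci = subst (λ w → EdgesConnect _ w (outer (end i))) (place-start i) (toEnd i (conducts i ci))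
    toOuter : ∀ u → Vertex u → ∃[ w ] EdgesConnect (assembled D H) u (outer w)
    toOuter _ (isOuter w) = w , ε
    -- Cutting a walk to `X` at the edge `XY` leaves a walk inside the copy to `X` or to `Y`.
    toOuter _ (isInner i v) with splitAtEdge (copies-span i (suc (suc v)) 0F)
    ... | inj₁ p              = start i , toStart i p
    ... | inj₂ (inj₁ (p , _)) = start i , toStart i p
    ... | inj₂ (inj₂ (p , _)) = end i , toEnd i p

  -- When `part b h` is a tree, `true` marks a spanning tree of the copy and `false` a spanning
  -- forest of two components that separates `X` from `Y`.
  part : Bool → Edges (2 ℕ.+ k) → Edges (2 ℕ.+ k)
  part b h = if b then h else (0F , 1F) ∷ h

  part-closed : ∀ b h → Spans ((0F , 1F) ∷ h) → does (edgesConnect? h 0F 1F) ≡ b → Spans (part b h)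
  part-closed false h spans _ = spans
  part-closed true  h spans c u v with edgesConnect? h 0F 1F
  part-closed true  h spans () u v | no _
  ... | yes 0~1 = ~-map id (λ { (here refl) → 0~1 ; (there e∈) → edge e∈ }) (spans u v)

  open Collapse using (closed)

  module _ (D : Edges 4) (H : Fin 4 → Edges (2 ℕ.+ k)) where

    private
      c : Fin 4 → Bool
      c = closed D H

      #parts : Fin 4 → ℕ
      #parts i = suc (length (part (c i) (H i)))

    -- Each copy supplies either a skeleton edge or the extra edge `XY` of its part. With
    -- `vertex-count` this says that the excess, edges plus one minus vertices, of the assembled
    -- graph is the sum of the excesses of the skeleton and the parts.
    edge-count : suc (length (skeleton D c)) ℕ.+ ∑₄ #parts ≡ suc (length (assembled D H)) ℕ.+ ∑₄ (λ _ → 2)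
    edge-count = trans
      (cong (λ x → suc x ℕ.+ ∑₄ #parts) (length-network D (switch c)))
      (trans (cong suc (trans (ℕ.+-assoc (length D) _ _) (trans
        (cong (length D ℕ.+_) (trans (sym (∑₄-+ (length ∘ switch c) #parts))
          (trans (∑₄-cong (λ i → balance (c i) (H i) i)) (∑₄-+ (length ∘ H) (λ _ → 2)))))
        (sym (ℕ.+-assoc (length D) (∑₄ (length ∘ H)) (∑₄ (λ _ → 2)))))))
      (cong (λ x → suc x ℕ.+ ∑₄ (λ _ → 2)) (sym (trans
        (length-network (map (both outer) D) (λ i → map (both (place i)) (H i)))
        (cong₂ ℕ._+_ (List.length-map (both outer) D)
                     (∑₄-cong (λ i → List.length-map (both (place i)) (H i))))))))
      where
      balance : ∀ b h i → length (if b then (start i , end i) ∷ [] else []) ℕ.+ suc (length (part b h))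
                          ≡ length h ℕ.+ 2
      balance true  h i = ℕ.+-comm 2 (length h)
      balance false h i = ℕ.+-comm 2 (length h)

    vertex-count : V ℕ.+ ∑₄ (λ _ → 2) ≡ 4 ℕ.+ ∑₄ (λ _ → 2 ℕ.+ k)
    vertex-count = lemma k
      where
      lemma : ∀ k → 4 ℕ.+ 4 ℕ.* k ℕ.+ 8 ≡ 4 ℕ.+ (2 ℕ.+ k ℕ.+ (2 ℕ.+ k ℕ.+ (2 ℕ.+ k ℕ.+ (2 ℕ.+ k))))
      lemma = solve-∀

    -- Skeleton and parts are connected, so their excesses are nonnegative; their sum is the excess
    -- of a tree, 0, so each of them vanishes.
    assembled-tree⇒ : SpanningTree (assembled D H) →
                      SpanningTree (skeleton D c) × (∀ i → SpanningTree (part (c i) (H i)))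
    assembled-tree⇒ (spans , count) =
      (skeleton-spans , sym (proj₁ tightness)) , λ i → parts-span i ,
        sym (tight₄ {g = #parts} (λ i → connected⇒vertices≤ (parts-span i)) (sym (proj₂ tightness)) i)
      where
      skeleton-spans : Spans (skeleton D c)
      skeleton-spans = Collapse.spans-skeleton D H spans
      parts-span : ∀ i → Spans (part (c i) (H i))
      parts-span i = part-closed (c i) (H i) (Retraction.spans-copy i D H spans) refl
      tightness : 4 ≡ suc (length (skeleton D c)) × ∑₄ (λ _ → 2 ℕ.+ k) ≡ ∑₄ #parts
      tightness = tight (connected⇒vertices≤ skeleton-spans)
        (∑₄-mono {g = #parts} (λ i → connected⇒vertices≤ (parts-span i)))
        (trans edge-count (trans (cong (ℕ._+ ∑₄ (λ _ → 2)) count) vertex-count))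

    ⇒assembled-tree : SpanningTree (skeleton D c) → (∀ i → SpanningTree (part (c i) (H i))) →
                      SpanningTree (assembled D H)
    ⇒assembled-tree (skeleton-spans , count) parts =
      spans-assembled D H c skeleton-spans (λ i → copy-spans (c i) (proj₁ (parts i))) conducts ,
      ℕ.+-cancelʳ-≡ (∑₄ (λ _ → 2)) _ V (trans (sym edge-count)
        (trans (cong₂ ℕ._+_ count (∑₄-cong {#parts} (λ i → proj₂ (parts i)))) (sym vertex-count)))
      where
      copy-spans : ∀ b {h} → Spans (part b h) → Spans ((0F , 1F) ∷ h)
      copy-spans true  spans u v = ~-map id (λ e∈ → edge (there e∈)) (spans u v)
      copy-spans false spans     = spans
      conducts : ∀ i → c i ≡ true → EdgesConnect (H i) 0F 1F
      conducts i ci with edgesConnect? (H i) 0F 1F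
      ... | yes p = p

-- Expansion of the tree count over the four copies

⟦⟧-× : (p? : Dec P) (q? : Dec Q) → ⟦ p? ×-dec q? ⟧ ≡ ⟦ p? ⟧ ℕ.* ⟦ q? ⟧
⟦⟧-× (yes _) (yes _) = refl
⟦⟧-× (yes _) (no _)  = refl
⟦⟧-× (no _)  _       = refl

∑B : (Bool → ℕ) → ℕ
∑B f = f true ℕ.+ f false

∑B-cong : ∀ {f g} → (∀ b → f b ≡ g b) → ∑B f ≡ ∑B g
∑B-cong f≡g = cong₂ ℕ._+_ (f≡g true) (f≡g false)

∑B-* : ∀ c f → ∑B (λ b → c ℕ.* f b) ≡ c ℕ.* ∑B f
∑B-* c f = sym (ℕ.*-distribˡ-+ c (f true) (f false))

abstract

  -- Keeping this abstract lets unification recover w and f.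
  ∑B[_]_ : (Bool → ℕ) → (Bool → ℕ) → ℕ
  ∑B[ w ] f = ∑B (λ b → w b ℕ.* f b)

  ∑B[]-pick : ∀ (w f : Bool → ℕ) c → w (not c) ≡ 0 → ∑B[ w ] f ≡ w c ℕ.* f c
  ∑B[]-pick w f true  w≡0 rewrite w≡0 = ℕ.+-identityʳ _
  ∑B[]-pick w f false w≡0 rewrite w≡0 = refl

  -- The weights belong to a copy fixed further out, so the sum over `h` passes through them.
  ∑⊆-inner : ∀ {w : Bool → ℕ} {f : Bool → List A → ℕ} {F} xs → (∀ b → ∑⊆ (f b) xs ≡ F b) →
             ∑⊆ (λ h → ∑B[ w ] (λ b → f b h)) xs ≡ ∑B[ w ] F
  ∑⊆-inner {w = w} {f} {F} xs eq =
    trans (∑⊆-+ (λ h → w true ℕ.* f true h) (λ h → w false ℕ.* f false h) xs)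
          (∑B-cong {f = λ b → ∑⊆ (λ h → w b ℕ.* f b h) xs}
                   (λ b → trans (∑⊆-* (w b) (f b) xs) (cong (w b ℕ.*_) (eq b))))

  -- Here the weights depend on the summed copy. Because both have the same total `N`, it factors
  -- out whatever `f` is.
  ∑⊆-outer : ∀ {w : Bool → List A → ℕ} {f N} xs → (∀ b → ∑⊆ (w b) xs ≡ N) →
             ∑⊆ (λ h → ∑B[ (λ b → w b h) ] f) xs ≡ N ℕ.* ∑B f
  ∑⊆-outer {w = w} {f} {N} xs eq =
    trans (∑⊆-+ (λ h → w true h ℕ.* f true) (λ h → w false h ℕ.* f false) xs)
    (trans (∑B-cong {f = λ b → ∑⊆ (λ h → w b h ℕ.* f b) xs} λ b →
      trans (∑⊆-cong (λ h → ℕ.*-comm (w b h) (f b)) xs)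
      (trans (∑⊆-* (f b) (w b) xs) (trans (cong (f b ℕ.*_) (eq b)) (ℕ.*-comm (f b) N))))
    (∑B-* N f))

four : A → A → A → A → Fin 4 → A
four a b c d 0F = a
four a b c d 1F = b
four a b c d 2F = c
four a b c d 3F = d

module _ (k : ℕ) where
  open Gluing k

  weight : Bool → Edges (2 ℕ.+ k) → ℕ
  weight b h = ⟦ spanningTree? (part b h) ⟧

  skeletonTree : Edges 4 → Bool → Bool → Bool → Bool → ℕ
  skeletonTree D b₀ b₁ b₂ b₃ = ⟦ spanningTree? (skeleton D (four b₀ b₁ b₂ b₃)) ⟧

  -- In the open case `XY` is an edge of a tree; were `X` and `Y` already connected, `h` would span
  -- with one edge too few.
  tree⇒closed : ∀ b h → SpanningTree (part b h) → does (edgesConnect? h 0F 1F) ≡ b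
  tree⇒closed true  h (spans , _) = dec-true (edgesConnect? h 0F 1F) (spans 0F 1F)
  tree⇒closed false h (spans , count) = dec-false (edgesConnect? h 0F 1F) λ 0~1 →
    ℕ.1+n≰n (ℕ.≤-trans (ℕ.≤-reflexive count) (connected⇒vertices≤ {es = h}
      (λ u v → ~-map id (λ { (here refl) → 0~1 ; (there e∈) → edge e∈ }) (spans u v))))

  weight-other : ∀ h → weight (not (does (edgesConnect? h 0F 1F))) h ≡ 0
  weight-other h = cong (if_then 1 else 0)
    (dec-false (spanningTree? (part _ h)) λ t → ≢not (tree⇒closed _ h t))
    where
    ≢not : ∀ {b} → b ≢ not b
    ≢not {true}  ()
    ≢not {false} ()

  -- By `weight-other` only the term survives in which each flag tells whether its copy connects `X`
  -- to `Y`; that term is the tree criterion for the assembled graph.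
  tree-expansion : ∀ D h₀ h₁ h₂ h₃ → ⟦ spanningTree? (assembled D (four h₀ h₁ h₂ h₃)) ⟧ ≡
    ∑B[ (λ b → weight b h₀) ] λ b₀ → ∑B[ (λ b → weight b h₁) ] λ b₁ →
    ∑B[ (λ b → weight b h₂) ] λ b₂ → ∑B[ (λ b → weight b h₃) ] λ b₃ → skeletonTree D b₀ b₁ b₂ b₃
  tree-expansion D h₀ h₁ h₂ h₃ = trans asProduct (sym (
    trans (pick 0F _) (cong (⟦ t? 0F ⟧ ℕ.*_) (
    trans (pick 1F _) (cong (⟦ t? 1F ⟧ ℕ.*_) (
    trans (pick 2F _) (cong (⟦ t? 2F ⟧ ℕ.*_) (pick 3F _))))))))
    where
    H : Fin 4 → Edges (2 ℕ.+ k)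
    H = four h₀ h₁ h₂ h₃
    c : Fin 4 → Bool
    c = Collapse.closed D H
    t? : ∀ i → Dec (SpanningTree (part (c i) (H i)))
    t? i = spanningTree? (part (c i) (H i))
    -- A skeleton depends on its flags only at the four indices, so this is the skeleton of `c` by
    -- computation.
    s? : Dec (SpanningTree (skeleton D (four (c 0F) (c 1F) (c 2F) (c 3F))))
    s? = spanningTree? (skeleton D (four (c 0F) (c 1F) (c 2F) (c 3F)))

    pick : ∀ i f → ∑B[ (λ b → weight b (H i)) ] f ≡ ⟦ t? i ⟧ ℕ.* f (c i)
    pick i f = ∑B[]-pick (λ b → weight b (H i)) f (c i) (weight-other (H i))

    asProduct : ⟦ spanningTree? (assembled D H) ⟧ ≡
                ⟦ t? 0F ⟧ ℕ.* (⟦ t? 1F ⟧ ℕ.* (⟦ t? 2F ⟧ ℕ.* (⟦ t? 3F ⟧ ℕ.* ⟦ s? ⟧)))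
    asProduct = trans
      (⟦⟧-cong (spanningTree? (assembled D H)) (t? 0F ×-dec t? 1F ×-dec t? 2F ×-dec t? 3F ×-dec s?)
        (λ t → let s , p = assembled-tree⇒ D H t in p 0F , p 1F , p 2F , p 3F , s)
        (λ (p₀ , p₁ , p₂ , p₃ , s) → ⇒assembled-tree D H s λ { 0F → p₀ ; 1F → p₁ ; 2F → p₂ ; 3F → p₃ }))
      (trans (⟦⟧-× (t? 0F) (t? 1F ×-dec t? 2F ×-dec t? 3F ×-dec s?)) (cong (⟦ t? 0F ⟧ ℕ.*_)
      (trans (⟦⟧-× (t? 1F) (t? 2F ×-dec t? 3F ×-dec s?)) (cong (⟦ t? 1F ⟧ ℕ.*_)
      (trans (⟦⟧-× (t? 2F) (t? 3F ×-dec s?)) (cong (⟦ t? 2F ⟧ ℕ.*_)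
      (⟦⟧-× (t? 3F) s?)))))))

  module _ (es : Edges (2 ℕ.+ k)) where

    ∑⊆-copies : ∀ f → ∑⊆ f (concatMap (λ i → map (both (place i)) es) (allFin 4)) ≡
      ∑⊆ (λ h₀ → ∑⊆ (λ h₁ → ∑⊆ (λ h₂ → ∑⊆ (λ h₃ →
        f (concatMap (λ i → map (both (place i)) (four h₀ h₁ h₂ h₃ i)) (allFin 4))) es) es) es) es
    ∑⊆-copies f =
      trans (copy 0F f _) (∑⊆-cong (λ h₀ →
      trans (copy 1F (λ r → f (map (both (place 0F)) h₀ ++ r)) _) (∑⊆-cong (λ h₁ →
      trans (copy 2F (λ r → f (map (both (place 0F)) h₀ ++ map (both (place 1F)) h₁ ++ r)) _) (∑⊆-cong (λ h₂ →
      copy 3F (λ r → f (map (both (place 0F)) h₀ ++ map (both (place 1F)) h₁ ++ map (both (place 2F)) h₂ ++ r)) [])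
      es)) es)) es)
      where
      copy : ∀ i f ys → ∑⊆ f (map (both (place i)) es ++ ys) ≡
             ∑⊆ (λ h → ∑⊆ (λ r → f (map (both (place i)) h ++ r)) ys) es
      copy i f ys = trans (∑⊆-++ f (map (both (place i)) es) ys) (∑⊆-map _ (both (place i)) es)

    -- Summing over the copies one at a time, from the last to the first, gives a factor `N` each;
    -- the remaining sum counts the flags for which `D` extends to a spanning tree of the skeleton.
    #assembled : ∀ {N} → (∀ b → ∑⊆ (weight b) es ≡ N) → ∀ D →
      ∑⊆ (λ h → ⟦ spanningTree? (map (both outer) D ++ h) ⟧)
         (concatMap (λ i → map (both (place i)) es) (allFin 4)) ≡
      N ℕ.* (N ℕ.* (N ℕ.* (N ℕ.* (∑B λ b₀ → ∑B λ b₁ → ∑B λ b₂ → ∑B λ b₃ → skeletonTree D b₀ b₁ b₂ b₃))))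
    #assembled {N} #weight D = trans (∑⊆-copies (λ h → ⟦ spanningTree? (map (both outer) D ++ h) ⟧))
      (trans (∑⊆-cong (λ h₀ → trans (∑⊆-cong (λ h₁ → trans (∑⊆-cong (λ h₂ →
        trans (∑⊆-cong (tree-expansion D h₀ h₁ h₂) es)
              (∑⊆-inner es λ _ → ∑⊆-inner es λ _ → ∑⊆-inner es λ _ → ∑⊆-outer {w = weight} es #weight)) es)
              (∑⊆-inner es λ _ → ∑⊆-inner es λ _ → ∑⊆-outer {w = weight} es #weight)) es)
              (∑⊆-inner es λ _ → ∑⊆-outer {w = weight} es #weight)) es)
      (trans (∑⊆-outer {w = weight} es #weight)
        (cong (N ℕ.*_) hoist₀)))
      where
      S₃ : Bool → Bool → Bool → ℕ
      S₃ b₀ b₁ b₂ = ∑B (skeletonTree D b₀ b₁ b₂)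
      S₂ : Bool → Bool → ℕ
      S₂ b₀ b₁ = ∑B (S₃ b₀ b₁)
      S₁ : Bool → ℕ
      S₁ b₀ = ∑B (S₂ b₀)

      hoist₁ : ∀ b₀ → ∑B (λ b₁ → N ℕ.* ∑B (λ b₂ → N ℕ.* S₃ b₀ b₁ b₂)) ≡ N ℕ.* (N ℕ.* S₁ b₀)
      hoist₁ b₀ = trans (∑B-* N (λ b₁ → ∑B (λ b₂ → N ℕ.* S₃ b₀ b₁ b₂))) (cong (N ℕ.*_)
        (trans (∑B-cong {λ b₁ → ∑B (λ b₂ → N ℕ.* S₃ b₀ b₁ b₂)} (λ b₁ → ∑B-* N (S₃ b₀ b₁)))
               (∑B-* N (S₂ b₀))))

      hoist₀ : ∑B (λ b₀ → N ℕ.* ∑B (λ b₁ → N ℕ.* ∑B (λ b₂ → N ℕ.* S₃ b₀ b₁ b₂)))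
               ≡ N ℕ.* (N ℕ.* (N ℕ.* ∑B S₁))
      hoist₀ = trans (∑B-* N (λ b₀ → ∑B (λ b₁ → N ℕ.* ∑B (λ b₂ → N ℕ.* S₃ b₀ b₁ b₂)))) (cong (N ℕ.*_)
        (trans (∑B-cong {λ b₀ → ∑B (λ b₁ → N ℕ.* ∑B (λ b₂ → N ℕ.* S₃ b₀ b₁ b₂))} hoist₁)
               (trans (∑B-* N (λ b₀ → N ℕ.* S₁ b₀)) (cong (N ℕ.*_) (∑B-* N S₁)))))

-- The recursion for the two counts and its closed form

#forests : Edges (2 ℕ.+ k) → ℕ
#forests = ∑⊆ (λ h → ⟦ spanningTree? ((0F , 1F) ∷ h) ⟧)

octuple : ∀ N → N ℕ.* (N ℕ.* (N ℕ.* (N ℕ.* 4))) ℕ.+ N ℕ.* (N ℕ.* (N ℕ.* (N ℕ.* 4))) ≡ 8 ℕ.* (N ℕ.* (N ℕ.* (N ℕ.* N)))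
octuple = solve-∀

module _ (M : Marked) {N : ℕ} (#t : #trees (edgeList M) ≡ N) (#f : #forests (edgeList M) ≡ N) where

  private
    #weight : ∀ b → ∑⊆ (weight (inner M) b) (edgeList M) ≡ N
    #weight true  = #t
    #weight false = #f

  -- The 4-cycle `X a Y b` has 4 spanning trees, and 4 more trees contain the diagonal `ab`.
  #trees-glue : #trees (edgeList (glue M)) ≡ 8 ℕ.* (N ℕ.* (N ℕ.* (N ℕ.* N)))
  #trees-glue =  trans (cong₂ ℕ._+_ (#assembled (inner M) (edgeList M) #weight ((2F , 3F) ∷ []))
                                   (#assembled (inner M) (edgeList M) #weight []))
                      (octuple N)

  -- With `XY` forced there are again 4 skeleton trees containing `ab` and 4 avoiding it.
  #forests-glue : #forests (edgeList (glue M)) ≡ 8 ℕ.* (N ℕ.* (N ℕ.* (N ℕ.* N)))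
  #forests-glue = trans (cong₂ ℕ._+_ (#assembled (inner M) (edgeList M) #weight ((0F , 1F) ∷ (2F , 3F) ∷ []))
                                     (#assembled (inner M) (edgeList M) #weight ((0F , 1F) ∷ [])))
                        (octuple N)

-- (4ⁿ − 1) / 3: the graph Gₙ has 2 + 2 κ n vertices and 8 ^ κ n spanning trees.
κ : ℕ → ℕ
κ zero    = 0
κ (suc n) = 1 ℕ.+ 4 ℕ.* κ n

n≤κ : ∀ n → n ℕ.≤ κ n
n≤κ zero    = z≤n
n≤κ (suc n) = s≤s (ℕ.≤-trans (n≤κ n) (ℕ.m≤m+n (κ n) _))

4^n∸1≡3κ : ∀ n → 4 ^ n ∸ 1 ≡ κ n ℕ.* 3
4^n∸1≡3κ n = cong (_∸ 1) (4^n≡ n)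
  where
  4^n≡ : ∀ n → 4 ^ n ≡ suc (κ n ℕ.* 3)
  4^n≡ zero    = refl
  4^n≡ (suc n) = trans (cong (4 ℕ.*_) (4^n≡ n)) (step (κ n))
    where
    step : ∀ q → 4 ℕ.* suc (q ℕ.* 3) ≡ suc ((1 ℕ.+ 4 ℕ.* q) ℕ.* 3)
    step = solve-∀

inner≡2κ : ∀ n → inner (markedG n) ≡ 2 ℕ.* κ n
inner≡2κ zero    = refl
inner≡2κ (suc n) = trans (cong (λ k → 2 ℕ.+ 4 ℕ.* k) (inner≡2κ n)) (step (κ n))
  where
  step : ∀ q → 2 ℕ.+ 4 ℕ.* (2 ℕ.* q) ≡ 2 ℕ.* (1 ℕ.+ 4 ℕ.* q)
  step = solve-∀

8^κ≡ : ∀ n → 8 ^ ((4 ^ n ∸ 1) div 3) ≡ 2 ^ (4 ^ n ∸ 1)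
8^κ≡ n rewrite 4^n∸1≡3κ n = begin
  8 ^ ((κ n ℕ.* 3) div 3)  ≡⟨ cong (8 ^_) (ℕ.m*n/n≡m (κ n) 3) ⟩
  (2 ^ 3) ^ κ n            ≡⟨ ℕ.^-*-assoc 2 3 (κ n) ⟩
  2 ^ (3 ℕ.* κ n)          ≡⟨ cong (2 ^_) (ℕ.*-comm 3 (κ n)) ⟩
  2 ^ (κ n ℕ.* 3)          ∎
  where open ≡-Reasoning

octuple-2^ : ∀ m → 8 ℕ.* (2 ^ m ℕ.* (2 ^ m ℕ.* (2 ^ m ℕ.* 2 ^ m))) ≡ 2 ^ (3 ℕ.+ 4 ℕ.* m)
octuple-2^ m = begin
  8 ℕ.* (2 ^ m ℕ.* (2 ^ m ℕ.* (2 ^ m ℕ.* 2 ^ m)))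
    ≡⟨ cong (λ x → 8 ℕ.* (2 ^ m ℕ.* (2 ^ m ℕ.* (2 ^ m ℕ.* x)))) (ℕ.*-identityʳ (2 ^ m)) ⟨
  2 ^ 3 ℕ.* (2 ^ m) ^ 4
    ≡⟨ cong (2 ^ 3 ℕ.*_) (trans (ℕ.^-*-assoc 2 m 4) (cong (2 ^_) (ℕ.*-comm m 4))) ⟩
  2 ^ 3 ℕ.* 2 ^ (4 ℕ.* m)
    ≡⟨ ℕ.^-distribˡ-+-* 2 3 (4 ℕ.* m) ⟨
  2 ^ (3 ℕ.+ 4 ℕ.* m) ∎
  where open ≡-Reasoning

#trees≡#forests≡2^ : ∀ n → #trees (edgeList (markedG n)) ≡ 2 ^ (κ n ℕ.* 3) ×
                           #forests (edgeList (markedG n)) ≡ 2 ^ (κ n ℕ.* 3)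
#trees≡#forests≡2^ zero    = refl , refl
#trees≡#forests≡2^ (suc n) =
  let #t , #f = #trees≡#forests≡2^ n
  in trans (#trees-glue (markedG n) #t #f) power , trans (#forests-glue (markedG n) #t #f) power
  where
  step : ∀ q → 3 ℕ.+ 4 ℕ.* (q ℕ.* 3) ≡ (1 ℕ.+ 4 ℕ.* q) ℕ.* 3
  step = solve-∀
  power = trans (octuple-2^ (κ n ℕ.* 3)) (cong (2 ^_) (step (κ n)))

spans? : ∀ {n} (es : Edges n) → Dec (Spans es)
spans? es = Fin.all? λ u → Fin.all? (edgesConnect? es u)

spans-G : ∀ n → Spans (edgeList (markedG n))
spans-G zero    = toWitness {a? = spans? ((0F , 1F) ∷ [])} _
spans-G (suc n) = Gluing.spans-assembled (inner (markedG n)) ((2F , 3F) ∷ []) (λ _ → edgeList (markedG n))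
  (λ _ → true)
  (toWitness {a? = spans? (skeleton ((2F , 3F) ∷ []) (λ _ → true))} _)
  (λ _ u v → ~-map id (λ e∈ → edge (there e∈)) (spans-G n u v))
  (λ _ _ → spans-G n 0F 1F)

τ-G : ∀ n → τ (G n) ≡ 2 ^ (4 ^ n ∸ 1)
τ-G n = trans (τ≡#trees (edgeList (markedG n)))
  (trans (proj₁ (#trees≡#forests≡2^ n)) (cong (2 ^_) (sym (4^n∸1≡3κ n))))

tutte-G : ∀ n → tutte (G n) 1ℤ 1ℤ ≡ + τ (G n)
tutte-G n = trans (tutte≡#trees (edgeList (markedG n)) (spans-G n))
                  (cong +_ (sym (τ≡#trees (edgeList (markedG n)))))

-- Riemann sums of the logarithm

≤-decide : ∀ {p q} {_ : True (p ℚ.≤? q)} → p ℚ.≤ q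
≤-decide {_} {_} {t} = toWitness t

fromℚᵘ-+ : ∀ p q → ℚ.fromℚᵘ p ℚ.+ ℚ.fromℚᵘ q ≡ ℚ.fromℚᵘ (p ℚᵘ.+ q)
fromℚᵘ-+ p q = ℚ.toℚᵘ-injective (ℚᵘ.≃-trans (ℚ.toℚᵘ-homo-+ (ℚ.fromℚᵘ p) (ℚ.fromℚᵘ q))
  (ℚᵘ.≃-trans (ℚᵘ.+-cong (ℚ.toℚᵘ-fromℚᵘ p) (ℚ.toℚᵘ-fromℚᵘ q)) (ℚᵘ.≃-sym (ℚ.toℚᵘ-fromℚᵘ (p ℚᵘ.+ q)))))

fromℚᵘ-* : ∀ p q → ℚ.fromℚᵘ p ℚ.* ℚ.fromℚᵘ q ≡ ℚ.fromℚᵘ (p ℚᵘ.* q)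
fromℚᵘ-* p q = ℚ.toℚᵘ-injective (ℚᵘ.≃-trans (ℚ.toℚᵘ-homo-* (ℚ.fromℚᵘ p) (ℚ.fromℚᵘ q))
  (ℚᵘ.≃-trans (ℚᵘ.*-cong (ℚ.toℚᵘ-fromℚᵘ p) (ℚ.toℚᵘ-fromℚᵘ q)) (ℚᵘ.≃-sym (ℚ.toℚᵘ-fromℚᵘ (p ℚᵘ.* q)))))

fromℚᵘ-mono-≤ : ∀ p q → p ℚᵘ.≤ q → ℚ.fromℚᵘ p ℚ.≤ ℚ.fromℚᵘ q
fromℚᵘ-mono-≤ p q p≤q = ℚ.toℚᵘ-cancel-≤
  (ℚᵘ.≤-respˡ-≃ (ℚᵘ.≃-sym (ℚ.toℚᵘ-fromℚᵘ p)) (ℚᵘ.≤-respʳ-≃ (ℚᵘ.≃-sym (ℚ.toℚᵘ-fromℚᵘ q)) p≤q))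

fromℕ : ℕ → ℚ
fromℕ n = + n / 1

fromℕ-suc : ∀ n → fromℕ (suc n) ≡ 1ℚ ℚ.+ fromℕ n
fromℕ-suc n = sym (trans (fromℚᵘ-+ one (ℚᵘ.mkℚᵘ (+ n) 0))
  (ℚ.fromℚᵘ-cong {one ℚᵘ.+ ℚᵘ.mkℚᵘ (+ n) 0} {ℚᵘ.mkℚᵘ (+ suc n) 0} (ℚᵘ.*≡* (arith (+ n)))))
  where
  one : ℚᵘ.ℚᵘ
  one = ℚᵘ.mkℚᵘ (+ 1) 0
  arith : ∀ n → (1ℤ ℤ.* 1ℤ ℤ.+ n ℤ.* 1ℤ) ℤ.* 1ℤ ≡ (1ℤ ℤ.+ n) ℤ.* 1ℤ
  arith = ℤ.solve-∀

/-* : ∀ a b c d e f → a ℕ.* c ℕ.* suc f ≡ e ℕ.* (suc b ℕ.* suc d) →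
      (+ a / suc b) ℚ.* (+ c / suc d) ≡ + e / suc f
/-* a b c d e f eq = trans (fromℚᵘ-* (ℚᵘ.mkℚᵘ (+ a) b) (ℚᵘ.mkℚᵘ (+ c) d))
  (ℚ.fromℚᵘ-cong {ℚᵘ.mkℚᵘ (+ a) b ℚᵘ.* ℚᵘ.mkℚᵘ (+ c) d} {ℚᵘ.mkℚᵘ (+ e) f} (ℚᵘ.*≡* (begin
    + a ℤ.* + c ℤ.* + suc f       ≡⟨ cong (ℤ._* + suc f) (ℤ.pos-* a c) ⟨
    + (a ℕ.* c) ℤ.* + suc f       ≡⟨ ℤ.pos-* (a ℕ.* c) (suc f) ⟨
    + (a ℕ.* c ℕ.* suc f)         ≡⟨ cong +_ eq ⟩
    + (e ℕ.* (suc b ℕ.* suc d))   ≡⟨ ℤ.pos-* e (suc b ℕ.* suc d) ⟩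
    + e ℤ.* + (suc b ℕ.* suc d)   ∎)))
  where open ≡-Reasoning

fromℕ-*3 : ∀ n → fromℕ (n ℕ.* 3) ≡ fromℕ n ℚ.* fromℕ 3
fromℕ-*3 n = sym (/-* n 0 3 0 (n ℕ.* 3) 0 refl)

fromℕ*unit : ∀ n → fromℕ (suc n) ℚ.* unit n ≡ 1ℚ
fromℕ*unit n = /-* (suc n) 0 1 n 1 0 (arith (suc n))
  where
  arith : ∀ n → n ℕ.* 1 ℕ.* 1 ≡ 1 ℕ.* (1 ℕ.* n)
  arith = solve-∀

unit-half : ∀ n → unit (suc (2 ℕ.* n)) ≡ ½ ℚ.* unit n
unit-half n = sym (/-* 1 1 1 n 1 (suc (2 ℕ.* n)) (arith n))
  where
  arith : ∀ n → 1 ℕ.* 1 ℕ.* suc (suc (2 ℕ.* n)) ≡ 1 ℕ.* (2 ℕ.* suc n)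
  arith = solve-∀

unit-convex : ∀ n → unit (suc n) ℚ.+ unit (suc n) ℚ.≤ unit n ℚ.+ unit (2 ℕ.+ n)
unit-convex n = subst₂ ℚ._≤_ (sym (fromℚᵘ-+ (u (suc n)) (u (suc n)))) (sym (fromℚᵘ-+ (u n) (u (2 ℕ.+ n))))
  (fromℚᵘ-mono-≤ (u (suc n) ℚᵘ.+ u (suc n)) (u n ℚᵘ.+ u (2 ℕ.+ n))
    -- `4 + 2n` is the difference of the two cross products.
    (ℚᵘ.*≤* (ℤ.+≤+ (ℕ.≤-trans (ℕ.m≤m+n lhs (4 ℕ.+ 2 ℕ.* n)) (ℕ.≤-reflexive (arith n))))))
  where
  u : ℕ → ℚᵘ.ℚᵘ
  u = ℚᵘ.mkℚᵘ (+ 1)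
  lhs : ℕ
  lhs = (1 ℕ.* (2 ℕ.+ n) ℕ.+ 1 ℕ.* (2 ℕ.+ n)) ℕ.* ((1 ℕ.+ n) ℕ.* (3 ℕ.+ n))
  arith : ∀ n → (1 ℕ.* (2 ℕ.+ n) ℕ.+ 1 ℕ.* (2 ℕ.+ n)) ℕ.* ((1 ℕ.+ n) ℕ.* (3 ℕ.+ n)) ℕ.+ (4 ℕ.+ 2 ℕ.* n)
              ≡ (1 ℕ.* (3 ℕ.+ n) ℕ.+ 1 ℕ.* (1 ℕ.+ n)) ℕ.* ((2 ℕ.+ n) ℕ.* (2 ℕ.+ n))
  arith = solve-∀

∑-nonNegative : ∀ n f → (∀ i → 0ℚ ℚ.≤ f i) → 0ℚ ℚ.≤ ∑ n f
∑-nonNegative zero    f 0≤f = ℚ.≤-refl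
∑-nonNegative (suc n) f 0≤f = ℚ.+-mono-≤ (∑-nonNegative n f 0≤f) (0≤f n)

∑-length : ∀ {m n} f → m ≡ n → ∑ m f ≡ ∑ n f
∑-length f refl = refl

-- With N = n + 1, `riemann m n` is the sum of 1/t over N < t ≤ mN. Cutting at (a + 1)N leaves a sum
-- of the same kind of mesh 1/((a + 1)N), whose index is `n + a * suc n`.
riemann-* : ∀ a b n → riemann (suc a ℕ.* suc b) n ≡ riemann (suc a) n ℚ.+ riemann (suc b) (n ℕ.+ a ℕ.* suc n)
riemann-* a b n = begin
  riemann (suc a ℕ.* suc b) n
    ≡⟨ ∑-length f (arith a b n) ⟩
  ∑ (a ℕ.* suc n ℕ.+ b ℕ.* suc (n ℕ.+ a ℕ.* suc n)) f
    ≡⟨ ∑-+ (a ℕ.* suc n) (b ℕ.* suc (n ℕ.+ a ℕ.* suc n)) f ⟩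
  riemann (suc a) n ℚ.+ ∑ (b ℕ.* suc (n ℕ.+ a ℕ.* suc n)) (λ j → f (a ℕ.* suc n ℕ.+ j))
    ≡⟨ cong (riemann (suc a) n ℚ.+_) (∑-cong (b ℕ.* suc (n ℕ.+ a ℕ.* suc n)) (λ j → cong unit (shift n (a ℕ.* suc n) j))) ⟩
  riemann (suc a) n ℚ.+ riemann (suc b) (n ℕ.+ a ℕ.* suc n) ∎
  where
  open ≡-Reasoning
  f : ℕ → ℚ
  f i = + 1 / (suc n ℕ.+ suc i)
  arith : ∀ a b n → (b ℕ.+ a ℕ.* suc b) ℕ.* suc n ≡ a ℕ.* suc n ℕ.+ b ℕ.* suc (n ℕ.+ a ℕ.* suc n)
  arith = solve-∀
  shift : ∀ n x j → n ℕ.+ suc (x ℕ.+ j) ≡ (n ℕ.+ x) ℕ.+ suc j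
  shift = solve-∀

∣riemann-riemann∣≤ : ∀ m {n p} → n ℕ.≤ p → ∣ riemann m p ℚ.- riemann m n ∣ ℚ.≤ unit n
∣riemann-riemann∣≤ m {n} {p} n≤p = ∣-∣≤ (riemann≤riemann+ m p n)
  (ℚ.≤-trans (riemann≤riemann+ m n p) (ℚ.+-monoʳ-≤ (riemann m p) (unit-antitone n≤p)))

-- Each factor 2 splits off a Riemann sum of `ln 2` whose mesh is no coarser than that of index `n`;
-- each such sum is off by at most `unit n`, and the errors add up.
∣riemann-2^∣≤ : ∀ m n → ∣ riemann (2 ^ m) n ℚ.- fromℕ m ℚ.* riemann 2 n ∣ ℚ.≤ fromℕ m ℚ.* unit n
∣riemann-2^∣≤ zero n = ℚ.≤-reflexive (trans
  (cong ∣_∣ (trans (cong (λ x → 0ℚ ℚ.- x) (ℚ.*-zeroˡ (riemann 2 n))) refl)) (sym (ℚ.*-zeroˡ (unit n))))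
∣riemann-2^∣≤ (suc m) n = begin
  ∣ riemann (2 ^ suc m) n ℚ.- fromℕ (suc m) ℚ.* r ∣
    ≡⟨ cong ∣_∣ (cong₂ (λ x y → x ℚ.- y ℚ.* r) split (fromℕ-suc m)) ⟩
  ∣ riemann (2 ^ m) n ℚ.+ r′ ℚ.- (1ℚ ℚ.+ fromℕ m) ℚ.* r ∣
    ≡⟨ cong ∣_∣ (regroup (riemann (2 ^ m) n) r′ (fromℕ m) r) ⟩
  ∣ (r′ ℚ.- r) ℚ.+ (riemann (2 ^ m) n ℚ.- fromℕ m ℚ.* r) ∣
    ≤⟨ ℚ.∣p+q∣≤∣p∣+∣q∣ (r′ ℚ.- r) _ ⟩
  ∣ r′ ℚ.- r ∣ ℚ.+ ∣ riemann (2 ^ m) n ℚ.- fromℕ m ℚ.* r ∣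
    ≤⟨ ℚ.+-mono-≤ (∣riemann-riemann∣≤ 2 (ℕ.m≤m+n n (a ℕ.* suc n))) (∣riemann-2^∣≤ m n) ⟩
  unit n ℚ.+ fromℕ m ℚ.* unit n
    ≡⟨ factor (unit n) (fromℕ m) ⟩
  (1ℚ ℚ.+ fromℕ m) ℚ.* unit n
    ≡⟨ cong (ℚ._* unit n) (fromℕ-suc m) ⟨
  fromℕ (suc m) ℚ.* unit n ∎
  where
  open ℚ.≤-Reasoning
  open ℚ.+-*-Solver
  instance
    2^m≢0 : ℕ.NonZero (2 ^ m)
    2^m≢0 = ℕ.m^n≢0 2 m
  a : ℕ
  a = ℕ.pred (2 ^ m)
  r r′ : ℚ
  r  = riemann 2 n
  r′ = riemann 2 (n ℕ.+ a ℕ.* suc n)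
  suc-a : suc a ≡ 2 ^ m
  suc-a = ℕ.suc-pred (2 ^ m)
  split : riemann (2 ^ suc m) n ≡ riemann (2 ^ m) n ℚ.+ r′
  split = trans (cong (λ x → riemann x n) (trans (ℕ.*-comm 2 (2 ^ m)) (cong (ℕ._* 2) (sym suc-a))))
    (trans (riemann-* a 1 n) (cong (λ x → riemann x n ℚ.+ r′) suc-a))
  regroup : ∀ x r′ m r → x ℚ.+ r′ ℚ.- (1ℚ ℚ.+ m) ℚ.* r ≡ (r′ ℚ.- r) ℚ.+ (x ℚ.- m ℚ.* r)
  regroup = solve 4 (λ x r′ m r → x :+ r′ :- (con 1ℚ :+ m) :* r := (r′ :- r) :+ (x :- m :* r)) refl
  factor : ∀ u m → u ℚ.+ m ℚ.* u ≡ (1ℚ ℚ.+ m) ℚ.* u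
  factor = solve 2 (λ u m → u :+ m :* u := (con 1ℚ :+ m) :* u) refl

-- The Riemann sums of ln 2 are H₂ₙ − Hₙ.
riemann2-suc : ∀ n → riemann 2 (suc n) ℚ.+ unit (suc n) ≡ riemann 2 n ℚ.+ (unit (2 ℕ.+ 2 ℕ.* n) ℚ.+ unit (3 ℕ.+ 2 ℕ.* n))
riemann2-suc n = begin
  riemann 2 (suc n) ℚ.+ unit (suc n)
    ≡⟨ cong₂ ℚ._+_ (trans (∑-length (λ i → unit (suc n ℕ.+ suc i)) (ℕ.*-identityˡ (2 ℕ.+ n)))
                          (∑-cong (2 ℕ.+ n) (λ i → cong unit (sym (ℕ.+-suc n (suc i)))))) (cong unit (sym (ℕ.+-comm n 1))) ⟩
  ∑ (2 ℕ.+ n) (f ∘ suc) ℚ.+ f 0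
    ≡⟨ ℚ.+-comm _ (f 0) ⟩
  f 0 ℚ.+ ∑ (2 ℕ.+ n) (f ∘ suc)
    ≡⟨ ∑-shift (2 ℕ.+ n) f ⟨
  ∑ (suc n) f ℚ.+ f (suc n) ℚ.+ f (2 ℕ.+ n)
    ≡⟨ ℚ.+-assoc (∑ (suc n) f) _ _ ⟩
  ∑ (suc n) f ℚ.+ (f (suc n) ℚ.+ f (2 ℕ.+ n))
    ≡⟨ cong₂ ℚ._+_ (∑-length f (sym (ℕ.*-identityˡ (suc n))))
         (cong₂ (λ x y → unit x ℚ.+ unit y) (arith₁ n) (arith₂ n)) ⟩
  riemann 2 n ℚ.+ (unit (2 ℕ.+ 2 ℕ.* n) ℚ.+ unit (3 ℕ.+ 2 ℕ.* n)) ∎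
  where
  open ≡-Reasoning
  f : ℕ → ℚ
  f i = unit (n ℕ.+ suc i)
  arith₁ : ∀ n → n ℕ.+ (2 ℕ.+ n) ≡ 2 ℕ.+ 2 ℕ.* n
  arith₁ = solve-∀
  arith₂ : ∀ n → n ℕ.+ (3 ℕ.+ n) ≡ 3 ℕ.+ 2 ℕ.* n
  arith₂ = solve-∀

-- The next two terms of the alternating harmonic series, since 1/(n+2) is twice 1/(2n+4).
increment : ∀ n → riemann 2 (suc n) ≡ riemann 2 n ℚ.+ (unit (2 ℕ.+ 2 ℕ.* n) ℚ.- unit (3 ℕ.+ 2 ℕ.* n))
increment n = begin
  riemann 2 (suc n)
    ≡⟨ insert (riemann 2 (suc n)) (unit (suc n)) ⟩
  riemann 2 (suc n) ℚ.+ unit (suc n) ℚ.- unit (suc n)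
    ≡⟨ cong (ℚ._- unit (suc n)) (riemann2-suc n) ⟩
  riemann 2 n ℚ.+ (b ℚ.+ c) ℚ.- unit (suc n)
    ≡⟨ cong (λ x → riemann 2 n ℚ.+ (b ℚ.+ x) ℚ.- unit (suc n)) c≡ ⟩
  riemann 2 n ℚ.+ (b ℚ.+ ½ ℚ.* unit (suc n)) ℚ.- unit (suc n)
    ≡⟨ regroup (riemann 2 n) b (unit (suc n)) ⟩
  riemann 2 n ℚ.+ (b ℚ.- ½ ℚ.* unit (suc n))
    ≡⟨ cong (λ x → riemann 2 n ℚ.+ (b ℚ.- x)) c≡ ⟨
  riemann 2 n ℚ.+ (b ℚ.- c) ∎
  where
  open ≡-Reasoning
  open ℚ.+-*-Solver
  b c : ℚ
  b = unit (2 ℕ.+ 2 ℕ.* n)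
  c = unit (3 ℕ.+ 2 ℕ.* n)
  c≡ : c ≡ ½ ℚ.* unit (suc n)
  c≡ = trans (cong (unit ∘ suc) (sym (ℕ.*-suc 2 n))) (unit-half (suc n))
  insert : ∀ s u → s ≡ s ℚ.+ u ℚ.- u
  insert = solve 2 (λ s u → s := s :+ u :- u) refl
  regroup : ∀ s b u → s ℚ.+ (b ℚ.+ ½ ℚ.* u) ℚ.- u ≡ s ℚ.+ (b ℚ.- ½ ℚ.* u)
  regroup = solve 3 (λ s b u → s :+ (b :+ con ½ :* u) :- u := s :+ (b :- con ½ :* u)) refl

-- The half terms accelerate the alternating series 1 − 1/2 + 1/3 − ⋯, whose partial sums
-- of even length are the Riemann sums of ln 2: both sequences have error O(1/n²).
upper lower : ℕ → ℚ
upper n = riemann 2 n ℚ.+ ½ ℚ.* unit (1 ℕ.+ 2 ℕ.* n)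
lower n = riemann 2 n ℚ.+ ½ ℚ.* unit (2 ℕ.+ 2 ℕ.* n)

-- Convexity of 1/x at 2n+2, 2n+3, 2n+4.
upper-step : ∀ n → upper (suc n) ℚ.≤ upper n
upper-step n = begin
  upper (suc n)                             ≡⟨ cong₂ (λ s u → s ℚ.+ ½ ℚ.* u) (increment n) (cong (unit ∘ suc) (ℕ.*-suc 2 n)) ⟩
  s ℚ.+ (b ℚ.- c) ℚ.+ ½ ℚ.* c               ≡⟨ regroup s b c ⟩
  s ℚ.- ½ ℚ.* c ℚ.+ ½ ℚ.* (b ℚ.+ b)         ≤⟨ ℚ.+-monoʳ-≤ (s ℚ.- ½ ℚ.* c) (ℚ.*-monoˡ-≤-nonNeg ½ (unit-convex (1 ℕ.+ 2 ℕ.* n))) ⟩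
  s ℚ.- ½ ℚ.* c ℚ.+ ½ ℚ.* (a ℚ.+ c)         ≡⟨ cancel s a c ⟩
  s ℚ.+ ½ ℚ.* a                             ∎
  where
  open ℚ.≤-Reasoning
  open ℚ.+-*-Solver
  s a b c : ℚ
  s = riemann 2 n
  a = unit (1 ℕ.+ 2 ℕ.* n)
  b = unit (2 ℕ.+ 2 ℕ.* n)
  c = unit (3 ℕ.+ 2 ℕ.* n)
  regroup : ∀ s b c → s ℚ.+ (b ℚ.- c) ℚ.+ ½ ℚ.* c ≡ s ℚ.- ½ ℚ.* c ℚ.+ ½ ℚ.* (b ℚ.+ b)
  regroup = solve 3 (λ s b c → s :+ (b :- c) :+ con ½ :* c := s :- con ½ :* c :+ con ½ :* (b :+ b)) refl
  cancel : ∀ s a c → s ℚ.- ½ ℚ.* c ℚ.+ ½ ℚ.* (a ℚ.+ c) ≡ s ℚ.+ ½ ℚ.* a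
  cancel = solve 3 (λ s a c → s :- con ½ :* c :+ con ½ :* (a :+ c) := s :+ con ½ :* a) refl

-- Convexity of 1/x at 2n+3, 2n+4, 2n+5.
lower-step : ∀ n → lower n ℚ.≤ lower (suc n)
lower-step n = begin
  s ℚ.+ ½ ℚ.* b                                   ≡⟨ regroup s b c ⟩
  s ℚ.+ ½ ℚ.* b ℚ.- c ℚ.+ ½ ℚ.* (c ℚ.+ c)         ≤⟨ ℚ.+-monoʳ-≤ (s ℚ.+ ½ ℚ.* b ℚ.- c) (ℚ.*-monoˡ-≤-nonNeg ½ (unit-convex (2 ℕ.+ 2 ℕ.* n))) ⟩
  s ℚ.+ ½ ℚ.* b ℚ.- c ℚ.+ ½ ℚ.* (b ℚ.+ d)         ≡⟨ cancel s b c d ⟩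
  s ℚ.+ (b ℚ.- c) ℚ.+ ½ ℚ.* d                     ≡⟨ cong₂ (λ s u → s ℚ.+ ½ ℚ.* u) (increment n) (cong (unit ∘ (2 ℕ.+_)) (ℕ.*-suc 2 n)) ⟨
  lower (suc n)                                   ∎
  where
  open ℚ.≤-Reasoning
  open ℚ.+-*-Solver
  s b c d : ℚ
  s = riemann 2 n
  b = unit (2 ℕ.+ 2 ℕ.* n)
  c = unit (3 ℕ.+ 2 ℕ.* n)
  d = unit (4 ℕ.+ 2 ℕ.* n)
  regroup : ∀ s b c → s ℚ.+ ½ ℚ.* b ≡ s ℚ.+ ½ ℚ.* b ℚ.- c ℚ.+ ½ ℚ.* (c ℚ.+ c)
  regroup = solve 3 (λ s b c → s :+ con ½ :* b := s :+ con ½ :* b :- c :+ con ½ :* (c :+ c)) refl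
  cancel : ∀ s b c d → s ℚ.+ ½ ℚ.* b ℚ.- c ℚ.+ ½ ℚ.* (b ℚ.+ d) ≡ s ℚ.+ (b ℚ.- c) ℚ.+ ½ ℚ.* d
  cancel = solve 4 (λ s b c d → s :+ con ½ :* b :- c :+ con ½ :* (b :+ d) := s :+ (b :- c) :+ con ½ :* d) refl

upper-antitone : ∀ {m n} → m ℕ.≤′ n → upper n ℚ.≤ upper m
upper-antitone ℕ.≤′-refl           = ℚ.≤-refl
upper-antitone (ℕ.≤′-step {n} m≤n) = ℚ.≤-trans (upper-step n) (upper-antitone {n = n} m≤n)

lower-monotone : ∀ {m n} → m ℕ.≤′ n → lower m ℚ.≤ lower n
lower-monotone ℕ.≤′-refl           = ℚ.≤-refl
lower-monotone (ℕ.≤′-step {n} m≤n) = ℚ.≤-trans (lower-monotone {n = n} m≤n) (lower-step n)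

p≤p+q : ∀ p {q} → 0ℚ ℚ.≤ q → p ℚ.≤ p ℚ.+ q
p≤p+q p 0≤q = ℚ.≤-trans (ℚ.≤-reflexive (sym (ℚ.+-identityʳ p))) (ℚ.+-monoʳ-≤ p 0≤q)

*-nonNegative : ∀ {p q} → 0ℚ ℚ.≤ p → 0ℚ ℚ.≤ q → 0ℚ ℚ.≤ p ℚ.* q
*-nonNegative {p} {q} 0≤p 0≤q =
  ℚ.nonNegative⁻¹ (p ℚ.* q) {{ℚ.nonNeg*nonNeg⇒nonNeg p {{ℚ.nonNegative 0≤p}} q {{ℚ.nonNegative 0≤q}}}}

riemann2≤upper : ∀ {m n} → m ℕ.≤ n → riemann 2 n ℚ.≤ upper m
riemann2≤upper {m} {n} m≤n = ℚ.≤-trans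
  (p≤p+q (riemann 2 n) (*-nonNegative {½} ≤-decide (unit-nonNegative (1 ℕ.+ 2 ℕ.* n))))
  (upper-antitone {m} {n} (ℕ.≤⇒≤′ m≤n))

-- The half term of `lower n` exceeds the Riemann sum; it is kept as an error that tends to 0 with
-- `n`.
lower≤riemann2 : ∀ {m n} → m ℕ.≤ n → lower m ℚ.≤ riemann 2 n ℚ.+ ½ ℚ.* unit n
lower≤riemann2 {m} {n} m≤n = ℚ.≤-trans (lower-monotone {m} {n} (ℕ.≤⇒≤′ m≤n))
  (ℚ.+-monoʳ-≤ (riemann 2 n) (ℚ.*-monoˡ-≤-nonNeg ½
    (unit-antitone (ℕ.≤-trans (ℕ.m≤m+n n _) (ℕ.m≤n+m (2 ℕ.* n) 2)))))

riemann2≤1 : ∀ n → riemann 2 n ℚ.≤ 1ℚ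
-- `upper 0` is 3/4.
riemann2≤1 n = ℚ.≤-trans (riemann2≤upper {0} {n} z≤n) ≤-decide

riemann2-nonNegative : ∀ n → 0ℚ ℚ.≤ riemann 2 n
riemann2-nonNegative n = ∑-nonNegative (1 ℕ.* suc n) _ (λ i → unit-nonNegative (n ℕ.+ suc i))

-- The numerical value of the growth constant

3/2 : ℚ
3/2 = + 3 / 2

growth-numeric : ∣ 3/2 · ln 2 - fromℚ (+ 10397 / 10000) ∣≤ (+ 1 / 20000)
-- Index 57 is large enough for `upper 57` and `lower 57`, multiplied by 3/2, to lie within 1/20000
-- of 1.0397 on the side needed; this is checked by rational computation. The other index makes the
-- leftover half term at most δ.
growth-numeric δ 0<δ = 57 ℕ.⊔ proj₁ K , λ k K≤k →
  ∣-∣≤ (above k (ℕ.m⊔n≤o⇒m≤o 57 (proj₁ K) K≤k))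
       (below k (ℕ.m⊔n≤o⇒m≤o 57 (proj₁ K) K≤k) (ℚ.≤-trans (unit-antitone (ℕ.m⊔n≤o⇒n≤o 57 (proj₁ K) K≤k)) (proj₂ K)))
  where
  open ℚ.≤-Reasoning
  open ℚ.+-*-Solver
  K : ∃[ K ] unit K ℚ.≤ δ
  K = unit-small δ 0<δ
  v r : ℚ
  v = + 10397 / 10000
  r = + 1 / 20000

  above : ∀ k → 57 ℕ.≤ k → 3/2 ℚ.* riemann 2 k ℚ.≤ v ℚ.+ (r ℚ.+ δ)
  above k 57≤k = begin
    3/2 ℚ.* riemann 2 k   ≤⟨ ℚ.*-monoˡ-≤-nonNeg 3/2 (riemann2≤upper {57} {k} 57≤k) ⟩
    3/2 ℚ.* upper 57      ≤⟨ ≤-decide ⟩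
    v ℚ.+ r               ≤⟨ ℚ.+-monoʳ-≤ v (p≤p+q r (ℚ.<⇒≤ 0<δ)) ⟩
    v ℚ.+ (r ℚ.+ δ)       ∎

  below : ∀ k → 57 ℕ.≤ k → unit k ℚ.≤ δ → v ℚ.≤ 3/2 ℚ.* riemann 2 k ℚ.+ (r ℚ.+ δ)
  below k 57≤k u≤δ = begin
    v                                                     ≤⟨ ≤-decide ⟩
    3/2 ℚ.* lower 57 ℚ.+ r                                ≤⟨ ℚ.+-monoˡ-≤ r (ℚ.*-monoˡ-≤-nonNeg 3/2 (lower≤riemann2 {57} {k} 57≤k)) ⟩
    3/2 ℚ.* (riemann 2 k ℚ.+ ½ ℚ.* unit k) ℚ.+ r          ≡⟨ distribute (riemann 2 k) (unit k) r ⟩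
    3/2 ℚ.* riemann 2 k ℚ.+ (r ℚ.+ (+ 3 / 4) ℚ.* unit k)  ≤⟨ ℚ.+-monoʳ-≤ (3/2 ℚ.* riemann 2 k) (ℚ.+-monoʳ-≤ r 3/4u≤δ) ⟩
    3/2 ℚ.* riemann 2 k ℚ.+ (r ℚ.+ δ)                     ∎
    where
    distribute : ∀ s u r → 3/2 ℚ.* (s ℚ.+ ½ ℚ.* u) ℚ.+ r ≡ 3/2 ℚ.* s ℚ.+ (r ℚ.+ (+ 3 / 4) ℚ.* u)
    distribute = solve 3 (λ s u r → con 3/2 :* (s :+ con ½ :* u) :+ r := con 3/2 :* s :+ (r :+ con (+ 3 / 4) :* u)) refl
    3/4u≤δ : (+ 3 / 4) ℚ.* unit k ℚ.≤ δ
    3/4u≤δ = begin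
      (+ 3 / 4) ℚ.* unit k  ≤⟨ ℚ.*-monoʳ-≤-nonNeg (unit k) {{ℚ.nonNegative (unit-nonNegative k)}} {+ 3 / 4} {1ℚ} ≤-decide ⟩
      1ℚ ℚ.* unit k         ≡⟨ ℚ.*-identityˡ (unit k) ⟩
      unit k                ≤⟨ u≤δ ⟩
      δ                     ∎

-- Convergence of the averaged logarithms

unit-below : ∀ δ → 0ℚ ℚ.< δ → ∃[ N ] ∀ n → N ℕ.≤ n → 3/2 ℚ.* unit n ℚ.≤ δ
unit-below δ 0<δ = proj₁ K , λ n N≤n → begin
  3/2 ℚ.* unit n         ≤⟨ ℚ.*-monoʳ-≤-nonNeg (unit n) {{ℚ.nonNegative (unit-nonNegative n)}} {3/2} {fromℕ 2} ≤-decide ⟩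
  fromℕ 2 ℚ.* unit n     ≤⟨ ℚ.*-monoˡ-≤-nonNeg (fromℕ 2) (ℚ.≤-trans (unit-antitone N≤n) (proj₂ K)) ⟩
  fromℕ 2 ℚ.* (½ ℚ.* δ)  ≡⟨ ℚ.*-assoc (fromℕ 2) ½ δ ⟨
  1ℚ ℚ.* δ               ≡⟨ ℚ.*-identityˡ δ ⟩
  δ                      ∎
  where
  open ℚ.≤-Reasoning
  K : ∃[ K ] unit K ℚ.≤ ½ ℚ.* δ
  K = unit-small (½ ℚ.* δ) (ℚ.positive⁻¹ (½ ℚ.* δ) {{ℚ.pos*pos⇒pos ½ δ {{ℚ.positive 0<δ}}}})

-- With u = 1/(m + 1) the difference is ½ u (ln 2³ᵐ − 3m ln 2) − (3/2) u ln 2.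
average-close : ∀ m k → ∣ unit (suc (2 ℕ.* m)) ℚ.* riemann (2 ^ (m ℕ.* 3)) k ℚ.- 3/2 ℚ.* riemann 2 k ∣
                        ℚ.≤ 3/2 ℚ.* unit m ℚ.+ 3/2 ℚ.* unit k
average-close m k = begin
  ∣ unit (suc (2 ℕ.* m)) ℚ.* R ℚ.- 3/2 ℚ.* r ∣
    ≡⟨ cong ∣_∣ (cong₂ (λ x y → x ℚ.* R ℚ.- 3/2 ℚ.* y) (unit-half m)
         (sym (trans (cong (ℚ._* r) M+1*u≡1) (ℚ.*-identityˡ r)))) ⟩
  ∣ ½ ℚ.* u ℚ.* R ℚ.- 3/2 ℚ.* ((1ℚ ℚ.+ M) ℚ.* u ℚ.* r) ∣
    ≡⟨ cong ∣_∣ (regroup u R M r) ⟩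
  ∣ ½ ℚ.* u ℚ.* (R ℚ.- M ℚ.* fromℕ 3 ℚ.* r) ℚ.+ ℚ.- (3/2 ℚ.* u ℚ.* r) ∣
    ≤⟨ ℚ.∣p+q∣≤∣p∣+∣q∣ (½ ℚ.* u ℚ.* (R ℚ.- M ℚ.* fromℕ 3 ℚ.* r)) _ ⟩
  ∣ ½ ℚ.* u ℚ.* (R ℚ.- M ℚ.* fromℕ 3 ℚ.* r) ∣ ℚ.+ ∣ ℚ.- (3/2 ℚ.* u ℚ.* r) ∣
    ≡⟨ cong₂ ℚ._+_ (trans (ℚ.∣p*q∣≡∣p∣*∣q∣ (½ ℚ.* u) (R ℚ.- M ℚ.* fromℕ 3 ℚ.* r))
                          (cong (ℚ._* E) (ℚ.0≤p⇒∣p∣≡p 0≤½u)))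
                   (trans (ℚ.∣-p∣≡∣p∣ (3/2 ℚ.* u ℚ.* r)) (ℚ.0≤p⇒∣p∣≡p (*-nonNegative 0≤3/2u (riemann2-nonNegative k)))) ⟩
  ½ ℚ.* u ℚ.* E ℚ.+ 3/2 ℚ.* u ℚ.* r
    ≤⟨ ℚ.+-mono-≤ (ℚ.*-monoˡ-≤-nonNeg (½ ℚ.* u) {{ℚ.nonNegative 0≤½u}} E≤)
                  (ℚ.*-monoˡ-≤-nonNeg (3/2 ℚ.* u) {{ℚ.nonNegative 0≤3/2u}} (riemann2≤1 k)) ⟩
  ½ ℚ.* u ℚ.* (M ℚ.* fromℕ 3 ℚ.* w) ℚ.+ 3/2 ℚ.* u ℚ.* 1ℚ
    -- The added term turns the factor `M` into `1 + M`, which cancels against `u`.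
    ≤⟨ p≤p+q _ (*-nonNegative (*-nonNegative {3/2} ≤-decide (unit-nonNegative k)) (unit-nonNegative m)) ⟩
  ½ ℚ.* u ℚ.* (M ℚ.* fromℕ 3 ℚ.* w) ℚ.+ 3/2 ℚ.* u ℚ.* 1ℚ ℚ.+ 3/2 ℚ.* w ℚ.* u
    ≡⟨ collect u M w ⟩
  3/2 ℚ.* u ℚ.+ 3/2 ℚ.* ((1ℚ ℚ.+ M) ℚ.* u ℚ.* w)
    ≡⟨ cong (λ x → 3/2 ℚ.* u ℚ.+ 3/2 ℚ.* x) (trans (cong (ℚ._* w) M+1*u≡1) (ℚ.*-identityˡ w)) ⟩
  3/2 ℚ.* u ℚ.+ 3/2 ℚ.* w ∎
  where
  open ℚ.≤-Reasoning
  open ℚ.+-*-Solver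
  u w r R M E : ℚ
  u = unit m
  w = unit k
  r = riemann 2 k
  R = riemann (2 ^ (m ℕ.* 3)) k
  M = fromℕ m
  E = ∣ R ℚ.- M ℚ.* fromℕ 3 ℚ.* r ∣
  0≤½u : 0ℚ ℚ.≤ ½ ℚ.* u
  0≤½u = *-nonNegative {½} ≤-decide (unit-nonNegative m)
  0≤3/2u : 0ℚ ℚ.≤ 3/2 ℚ.* u
  0≤3/2u = *-nonNegative {3/2} ≤-decide (unit-nonNegative m)
  M+1*u≡1 : (1ℚ ℚ.+ M) ℚ.* u ≡ 1ℚ
  M+1*u≡1 = trans (cong (ℚ._* u) (sym (fromℕ-suc m))) (fromℕ*unit m)
  E≤ : E ℚ.≤ M ℚ.* fromℕ 3 ℚ.* w
  E≤ = subst (λ x → ∣ R ℚ.- x ℚ.* r ∣ ℚ.≤ x ℚ.* w) (fromℕ-*3 m) (∣riemann-2^∣≤ (m ℕ.* 3) k)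
  regroup : ∀ u R M r → ½ ℚ.* u ℚ.* R ℚ.- 3/2 ℚ.* ((1ℚ ℚ.+ M) ℚ.* u ℚ.* r)
            ≡ ½ ℚ.* u ℚ.* (R ℚ.- M ℚ.* fromℕ 3 ℚ.* r) ℚ.+ ℚ.- (3/2 ℚ.* u ℚ.* r)
  regroup = solve 4 (λ u R M r → con ½ :* u :* R :- con 3/2 :* ((con 1ℚ :+ M) :* u :* r)
              := con ½ :* u :* (R :- M :* con (fromℕ 3) :* r) :+ :- (con 3/2 :* u :* r)) refl
  collect : ∀ u M w → ½ ℚ.* u ℚ.* (M ℚ.* fromℕ 3 ℚ.* w) ℚ.+ 3/2 ℚ.* u ℚ.* 1ℚ ℚ.+ 3/2 ℚ.* w ℚ.* u
            ≡ 3/2 ℚ.* u ℚ.+ 3/2 ℚ.* ((1ℚ ℚ.+ M) ℚ.* u ℚ.* w)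
  collect = solve 3 (λ u M w → con ½ :* u :* (M :* con (fromℕ 3) :* w) :+ con 3/2 :* u :* con 1ℚ :+ con 3/2 :* w :* u
              := con 3/2 :* u :+ con 3/2 :* ((con 1ℚ :+ M) :* u :* w)) refl

-- The two error terms of `average-close` are controlled separately: the first by `n`, through
-- `κ n`, for the limit, and the second by the index `k` of the rational approximations of the
-- reals.
growth-limit : (λ n → ln (τ (G n)) ÷ ∣V∣ (G n)) ⟶ (3/2 · ln 2)
growth-limit δ 0<δ = proj₁ N , λ n N≤n δ′ 0<δ′ →
  let K , small = unit-below δ′ 0<δ′
  in K , λ k K≤k → ℚ.≤-trans
    (subst (λ x → ∣ x ℚ.- 3/2 ℚ.* riemann 2 k ∣ ℚ.≤ 3/2 ℚ.* unit (κ n) ℚ.+ 3/2 ℚ.* unit k)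
           (sym (cong₂ (λ i t → unit (suc i) ℚ.* riemann t k) (inner≡2κ n)
                       (trans (τ-G n) (cong (2 ^_) (4^n∸1≡3κ n)))))
           (average-close (κ n) k))
    (ℚ.+-mono-≤ (proj₂ N (κ n) (ℕ.≤-trans N≤n (n≤κ n))) (small k K≤k))
  where
  N : ∃[ N ] ∀ n → N ℕ.≤ n → 3/2 ℚ.* unit n ℚ.≤ δ
  N = unit-below δ 0<δ

corollary5 : (∀ (n : ℕ) →
    (+ τ (G n) ≡ tutte (G n) 1ℤ 1ℤ) ×
    (tutte (G n) 1ℤ 1ℤ ≡ + (8 ^ ((4 ^ n ∸ 1) div 3))) ×
    (8 ^ ((4 ^ n ∸ 1) div 3) ≡ 2 ^ (4 ^ n ∸ 1))) ×
    ((λ n → ln (τ (G n)) ÷ ∣V∣ (G n)) ⟶ ((+ 3 / 2) · ln 2)) ×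
    (∣ (+ 3 / 2) · ln 2 - fromℚ (+ 10397 / 10000) ∣≤ (+ 1 / 20000))
corollary5 =
  (λ n → sym (tutte-G n) , trans (tutte-G n) (cong +_ (trans (τ-G n) (sym (8^κ≡ n)))) , 8^κ≡ n) ,
  growth-limit , growth-numeric
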